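{- Let $\lambda$ be an infinite cardinal, and let $\mathcal{K}$ be a structure-class such that $\mathcal{K}_\lambda$ is a subcanonical AP class satisfying the Tarski--Vaught $\lambda$-chain axiom ($\lambda$-TV). Then the following three conditions are equivalent: (1) $\mathcal{K}$ is Galois $\lambda$-stable. (2) The sheaf topos $\mathrm{Sh}(\mathcal{K}_\lambda^{\mathrm{op}},J_{\mathrm{at}})$ satisfies the axiom of choice for $\lambda^+$-indexed families. (3) $\mathrm{Sh}(\mathcal{K}_\lambda^{\mathrm{op}},J_{\mathrm{at}})$ satisfies the axiom of choice for $I$-indexed families for every (external) set $I$. Here $\lambda^+$ denotes the least cardinal greater than $\lambda$.
   Context: A structure-class is a category $\mathcal{K}$ with a faithful functor $|-|:\mathcal{K}\to\mathbf{Set}$ such that: (i) for each morphism $f$, $|f|$ is injective; (ii) if $|f|$ is a bijection then $f$ is an isomorphism; (iii) (transportability) for each object $A$ and bijection $\sigma:|A|\to X$ there is an isomorphism $\bar\sigma:A\to A^\sigma$ in $\mathcal{K}$ with $|A^\sigma|=X$, $|\bar\sigma|=\sigma$; (iv) for each set $X$ the objects $A$ with $|A|=X$ form a set. Objects are called structures and morphisms embeddings; one writes $A$ for $|A|$ and $f$ for $|f|$. $\mathcal{K}_\lambda$ is the full subcategory of structures whose carrier has cardinality at most $\lambda$; it is itself a structure-class and is essentially small, and (pre)sheaves on $\mathcal{K}_\lambda^{\mathrm{op}}$ are taken over an equivalent small category. Amalgamation property (AP) of $\mathcal{K}_\lambda$: for all $f:A\to B$, $g:A\to C$ in $\mathcal{K}_\lambda$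 there are $h:B\to D$, $k:C\to D$ in $\mathcal{K}_\lambda$ with $hf=kg$ (an amalgamation of $f,g$). Coherence axiom: for all morphisms $g:A\to C$, $h:B\to C$ and every function $f:|A|\to|B|$ with $|g|=|h|\circ f$ there is a morphism $\bar f:A\to B$ with $|\bar f|=f$. The atomic topology $J_{\mathrm{at}}$ on $\mathcal{K}_\lambda^{\mathrm{op}}$ is the Grothendieck topology whose covering families are exactly the nonempty families (so each embedding $A\to B$ gives a cover of $A$). It is subcanonical if every representable presheaf is a sheaf. $\mathcal{K}_\lambda$ is a subcanonical AP class if it satisfies the coherence axiom and the AP, and $J_{\mathrm{at}}$ on $\mathcal{K}_\lambda^{\mathrm{op}}$ is subcanonical. $\lambda$-TV for $\mathcal{K}_\lambda$: for every ordinal $0<\delta\le\lambda$ and every chain (functorial system) $(X_i\to X_j)_{i<j<\delta}$ in $\mathcal{K}_\lambda$, the colimit $\mathrm{colim}_{i<\delta}X_i$ exists, and the canonical map between $\mathrm{colim}_{i<\delta}|X_i|$ and $|\mathrm{colim}_{i<\delta}X_i|$ is bijective. (It makes no difference whether the colimit is required in $\mathcal{K}$ or in $\mathcal{K}_\lambda$.) A pointed extension over $A\in\mathcal{K}_\lambda$ is a pair $(f,z)$ with $f:A\to M$ in $\mathcal{K}_\lambda$ and $z\in M$. $(f:A\to M,s)$ and $(g:A\to N,t)$ are equivalent if there is an amalgamation $h:M\to L$, $k:N\to L$ of $f,g$ in $\mathcal{K}_\lambda$ with $h(s)=k(t)$ (an equivalence relation under AP). A Galois type over $A$ is an equivalence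 class of pointed extensions over $A$. $\mathcal{K}$ is Galois $\lambda$-stable if for every $A\in\mathcal{K}_\lambda$ there are at most $\lambda$ Galois types over $A$ (in $\mathcal{K}_\lambda$). A topos satisfies the axiom of choice for $\kappa$-indexed families if for every set $I$ of cardinality $\kappa$ and every family of epimorphisms $\{g_i:X_i\to Y_i\}_{i\in I}$ the product $\prod_i g_i:\prod_iX_i\to\prod_iY_i$ is an epimorphism. -}

module Defs where

open import Axiom.Extensionality.Propositional
  using (Extensionality; implicit-extensionality)
open import Axiom.UniquenessOfIdentityProofs.WithK using (uip)
open import Data.Nat.Base using (ℕ)
open import Data.Product using (Σ; Σ-syntax; ∃!; _×_; _,_; proj₁; proj₂)
open import Function.Bundles using (_↣_; _↔_; _⤖_; module Bijection)
open import Function.Definitions using (Congruent; Injective; Bijective)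
open import Induction.WellFounded using (WellFounded)
open import Level using (Level; _⊔_; suc)
open import Relation.Binary.Construct.Closure.Equivalence using (EqClosure)
open import Relation.Binary.Core using (Rel)
open import Relation.Binary.Definitions using (Irrelevant)
open import Relation.Binary.PropositionalEquality
  using (_≡_; refl; sym; trans; cong; subst)
open import Relation.Binary.Structures using (IsStrictTotalOrder)
open import Relation.Nullary.Negation using (¬_)

_≺_ : ∀ {a b} → Set a → Set b → Set (a ⊔ b)
A ≺ B = (A ↣ B) × ¬ (B ↣ A)

record Ordinal (ℓ : Level) : Set (suc ℓ) where
  infix 4 _<_
  field
    Carrier            : Set ℓ
    _<_                : Rel Carrier ℓ
    isStrictTotalOrder : IsStrictTotalOrder _≡_ _<_
    wellFounded        : WellFounded _<_
    <-irrelevant       : Irrelevant _<_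

-- α ≤ₒ β: α is isomorphic to an initial segment of β (possibly all of β).

record _≤ₒ_ {ℓ : Level} (α β : Ordinal ℓ) : Set ℓ where
  private
    module α = Ordinal α
    module β = Ordinal β
  field
    embed   : α.Carrier → β.Carrier
    mono    : ∀ {x y} → x α.< y → embed x β.< embed y
    initial : ∀ {x y} → y β.< embed x →
              Σ[ x′ ∈ α.Carrier ] (x′ α.< x × embed x′ ≡ y)

-- An initial ordinal; ∣ A ∣ ≤ κ then means ∣ A ∣ ↣ Carrier.

record Cardinal (ℓ : Level) : Set (suc ℓ) where
  field
    ordinal : Ordinal ℓ
  open Ordinal ordinal public
  field
    initial : ∀ x → ¬ (Carrier ↣ (Σ[ y ∈ Carrier ] y < x))

Infinite : ∀ {ℓ} → Cardinal ℓ → Set ℓ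
Infinite κ = ℕ ↣ Cardinal.Carrier κ

-- The cardinality of I is κ⁺, the least one above κ.

HasSuccessorCardinality : ∀ {ℓ} → Cardinal ℓ → Set ℓ → Set (suc ℓ)
HasSuccessorCardinality {ℓ} κ I =
  (Carrier ≺ I) × (∀ (J : Set ℓ) → Carrier ≺ J → I ↣ J)
  where
  open Cardinal κ

record Category (o h : Level) : Set (suc (o ⊔ h)) where
  infix  4 _⇒_
  infixr 9 _∘_
  field
    Obj       : Set o
    _⇒_       : Obj → Obj → Set h
    id        : ∀ {A} → A ⇒ A
    _∘_       : ∀ {A B C} → B ⇒ C → A ⇒ B → A ⇒ C
    identityˡ : ∀ {A B} (f : A ⇒ B) → id ∘ f ≡ f
    identityʳ : ∀ {A B} (f : A ⇒ B) → f ∘ id ≡ f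
    assoc     : ∀ {A B C D} (h : C ⇒ D) (g : B ⇒ C) (f : A ⇒ B) →
                (h ∘ g) ∘ f ≡ h ∘ (g ∘ f)

infix 10 _ᵒᵖ

_ᵒᵖ : ∀ {o h} → Category o h → Category o h
C ᵒᵖ = record
  { Obj       = Obj
  ; _⇒_       = λ A B → B ⇒ A
  ; id        = id
  ; _∘_       = λ f g → g ∘ f
  ; identityˡ = identityʳ
  ; identityʳ = identityˡ
  ; assoc     = λ h g f → sym (assoc f g h)
  }
  where
  open Category C

module _ {o h : Level} (C : Category o h) where
  open Category C

  IsIso : ∀ {A B} → A ⇒ B → Set h
  IsIso {A} {B} f = Σ[ g ∈ B ⇒ A ] (g ∘ f ≡ id × f ∘ g ≡ id)

  Epi : ∀ {A B} → A ⇒ B → Set (o ⊔ h)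
  Epi {_} {B} f = ∀ {Z} (u v : B ⇒ Z) → u ∘ f ≡ v ∘ f → u ≡ v

  record Product {i : Level} {I : Set i} (X : I → Obj) : Set (o ⊔ h ⊔ i) where
    field
      ∏         : Obj
      π         : ∀ i → ∏ ⇒ X i
      ⟨_⟩       : ∀ {Z} → (∀ i → Z ⇒ X i) → Z ⇒ ∏
      π-⟨⟩      : ∀ {Z} (f : ∀ i → Z ⇒ X i) i → π i ∘ ⟨ f ⟩ ≡ f i
      ⟨⟩-unique : ∀ {Z} (f : ∀ i → Z ⇒ X i) (u : Z ⇒ ∏) →
                  (∀ i → π i ∘ u ≡ f i) → u ≡ ⟨ f ⟩

  ∏-map : ∀ {i} {I : Set i} {X Y : I → Obj} (PX : Product X) (PY : Product Y) →
          (∀ i → X i ⇒ Y i) → Product.∏ PX ⇒ Product.∏ PY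
  ∏-map PX PY g = Product.⟨_⟩ PY (λ i → g i ∘ Product.π PX i)

  -- Products are unique up to isomorphism, so it does not matter that all of
  -- them are considered rather than a chosen one.

  ChoiceForFamiliesOver : ∀ {i} → Set i → Set (o ⊔ h ⊔ i)
  ChoiceForFamiliesOver I =
    ∀ (X Y : I → Obj) (g : ∀ i → X i ⇒ Y i) → (∀ i → Epi (g i)) →
    ∀ (PX : Product X) (PY : Product Y) → Epi (∏-map PX PY g)

  Amalgamation : ∀ {A B₁ B₂} → A ⇒ B₁ → A ⇒ B₂ → Set (o ⊔ h)
  Amalgamation {_} {B₁} {B₂} f g =
    Σ[ D ∈ Obj ] Σ[ h ∈ B₁ ⇒ D ] Σ[ k ∈ B₂ ⇒ D ] h ∘ f ≡ k ∘ g

  AmalgamationProperty : Set (o ⊔ h)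
  AmalgamationProperty =
    ∀ {A B₁ B₂} (f : A ⇒ B₁) (g : A ⇒ B₂) → Amalgamation f g

  record Chain {ℓ : Level} (δ : Ordinal ℓ) : Set (o ⊔ h ⊔ ℓ) where
    open Ordinal δ
    field
      X      : Carrier → Obj
      step   : ∀ {i j} → i < j → X i ⇒ X j
      step-∘ : ∀ {i j k} (p : i < j) (q : j < k) (r : i < k) →
               step q ∘ step p ≡ step r

  record Cocone {ℓ : Level} {δ : Ordinal ℓ} (S : Chain δ) : Set (o ⊔ h ⊔ ℓ) where
    open Ordinal δ
    open Chain S
    field
      apex    : Obj
      inj     : ∀ i → X i ⇒ apex
      commute : ∀ {i j} (p : i < j) → inj j ∘ step p ≡ inj i

  IsColimit : ∀ {ℓ} {δ : Ordinal ℓ} {S : Chain δ} → Cocone S → Set (o ⊔ h ⊔ ℓ)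
  IsColimit {S = S} L = ∀ (M : Cocone S) →
    ∃! _≡_ λ (u : apex L ⇒ apex M) → ∀ i → u ∘ inj L i ≡ inj M i
    where
    open Cocone

record Presheaf {o h : Level} (C : Category o h) (v : Level) :
                Set (o ⊔ h ⊔ suc v) where
  open Category C
  field
    F₀   : Obj → Set v
    F₁   : ∀ {A B} → A ⇒ B → F₀ B → F₀ A
    F-id : ∀ {A} (x : F₀ A) → F₁ id x ≡ x
    F-∘  : ∀ {A B D} (g : B ⇒ D) (f : A ⇒ B) (x : F₀ D) →
           F₁ (g ∘ f) x ≡ F₁ f (F₁ g x)

representable : ∀ {o h} (C : Category o h) → Category.Obj C → Presheaf C h
representable C B = record
  { F₀   = λ A → A ⇒ B
  ; F₁   = λ f x → x ∘ f
  ; F-id = identityʳ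
  ; F-∘  = λ g f x → sym (assoc x g f)
  }
  where
  open Category C

record Family {o h : Level} (C : Category o h) (v : Level)
              (A : Category.Obj C) : Set (o ⊔ h ⊔ suc v) where
  open Category C
  field
    Index : Set v
    dom   : Index → Obj
    arr   : ∀ i → dom i ⇒ A

CoveringFamilies : ∀ {o h} → Category o h → (v : Level) → Set (o ⊔ h ⊔ suc v)
CoveringFamilies C v = ∀ A → Family C v A → Set v

-- The atomic topology: a family covers precisely when it is nonempty.

Jat : ∀ {o h} (C : Category o h) {v : Level} → CoveringFamilies C v
Jat C A R = Family.Index R

module _ {o h v : Level} {C : Category o h} where
  open Category C

  -- C need not have pullbacks, so compatibility is tested on all
  -- commutative squares.

  Compatible : ∀ {A} (F : Presheaf C v) (R : Family C v A) →
               (∀ i → Presheaf.F₀ F (Family.dom R i)) → Set (o ⊔ h ⊔ v)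
  Compatible F R x =
    ∀ {i j Z} (p : Z ⇒ dom i) (q : Z ⇒ dom j) →
    arr i ∘ p ≡ arr j ∘ q → F₁ p (x i) ≡ F₁ q (x j)
    where
    open Presheaf F
    open Family R

  IsSheafFor : ∀ {A} → Presheaf C v → Family C v A → Set (o ⊔ h ⊔ v)
  IsSheafFor {A} F R =
    ∀ (x : ∀ i → F₀ (dom i)) → Compatible F R x →
    ∃! _≡_ λ (y : F₀ A) → ∀ i → F₁ (arr i) y ≡ x i
    where
    open Presheaf F
    open Family R

  IsSheaf : CoveringFamilies C v → Presheaf C v → Set (o ⊔ h ⊔ suc v)
  IsSheaf J F = ∀ {A} (R : Family C v A) → J A R → IsSheafFor F R

Subcanonical : ∀ {o h} (C : Category o h) → CoveringFamilies C h →
               Set (o ⊔ suc h)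
Subcanonical C J = ∀ B → IsSheaf J (representable C B)

record Sheaf {o h v : Level} (C : Category o h) (J : CoveringFamilies C v) :
             Set (o ⊔ h ⊔ suc v) where
  field
    presheaf : Presheaf C v
    isSheaf  : IsSheaf J presheaf
  open Presheaf presheaf public

record SheafMorphism {o h v : Level} {C : Category o h}
                     {J : CoveringFamilies C v} (F G : Sheaf C J) :
                     Set (o ⊔ h ⊔ v) where
  open Category C
  private
    module F = Sheaf F
    module G = Sheaf G
  field
    η       : ∀ A → F.F₀ A → G.F₀ A
    natural : ∀ {A B} (f : A ⇒ B) (x : F.F₀ B) →
              η A (F.F₁ f x) ≡ G.F₁ f (η B x)

-- Function extensionality is needed to identify morphisms with the same
-- components.

module _ (ext : ∀ {a b} → Extensionality a b) where

  SheafMorphism-≡ : ∀ {o h v : Level} {C : Category o h} {J : CoveringFamilies C v}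
                    {F G : Sheaf C J} {α β : SheafMorphism F G} →
                    (∀ A x → SheafMorphism.η α A x ≡ SheafMorphism.η β A x) →
                    α ≡ β
  SheafMorphism-≡ {o} {h} {v} {C = C} {F = F} {G = G} {α = α} {β = β} e =
    same (ext λ A → ext (e A)) (SheafMorphism.natural α) (SheafMorphism.natural β)
    where
    open Category C
    module F = Sheaf F
    module G = Sheaf G
    Natural : (∀ A → F.F₀ A → G.F₀ A) → Set (o ⊔ h ⊔ v)
    Natural η = ∀ {A B} (f : A ⇒ B) (x : F.F₀ B) →
                η A (F.F₁ f x) ≡ G.F₁ f (η B x)
    same : {η η′ : ∀ A → F.F₀ A → G.F₀ A} → η ≡ η′ →
           (n : Natural η) (n′ : Natural η′) →
           _≡_ {A = SheafMorphism F G}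
               (record { η = η ; natural = n }) (record { η = η′ ; natural = n′ })
    same {η} refl n n′ =
      cong (λ (m : Natural η) → record { η = η ; natural = m })
        (implicit-extensionality ext λ {A} →
         implicit-extensionality ext λ {B} →
         ext λ f → ext λ x → uip (n f x) (n′ f x))

  -- C may be large.  When it is essentially small this is equivalent to the category
  -- of sheaves on any small category equivalent to C.

  Sh : ∀ {o h v} (C : Category o h) → CoveringFamilies C v →
       Category (o ⊔ h ⊔ suc v) (o ⊔ h ⊔ v)
  Sh C J = record
    { Obj       = Sheaf C J
    ; _⇒_       = SheafMorphism
    ; id        = record { η = λ A x → x ; natural = λ f x → refl }
    ; _∘_       = λ β α → record
        { η       = λ A x → η β A (η α A x)
        ; natural = λ {A} {B} f x →
            trans (cong (η β A) (natural α f x)) (natural β f (η α B x))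
        }
    ; identityˡ = λ f → SheafMorphism-≡ λ A x → refl
    ; identityʳ = λ f → SheafMorphism-≡ λ A x → refl
    ; assoc     = λ h g f → SheafMorphism-≡ λ A x → refl
    }
    where
    open SheafMorphism

record ConcreteCategory (o ℓ : Level) : Set (suc (o ⊔ ℓ)) where
  field
    category : Category o ℓ
  open Category category public
  field
    ∣_∣      : Obj → Set ℓ
    ⟦_⟧      : ∀ {A B} → A ⇒ B → ∣ A ∣ → ∣ B ∣
    ⟦id⟧     : ∀ {A} (x : ∣ A ∣) → ⟦ id {A} ⟧ x ≡ x
    ⟦∘⟧      : ∀ {A B C} (g : B ⇒ C) (f : A ⇒ B) (x : ∣ A ∣) →
               ⟦ g ∘ f ⟧ x ≡ ⟦ g ⟧ (⟦ f ⟧ x)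
    faithful : ∀ {A B} {f g : A ⇒ B} → (∀ x → ⟦ f ⟧ x ≡ ⟦ g ⟧ x) → f ≡ g

record StructureClass (o ℓ : Level) : Set (suc (o ⊔ ℓ)) where
  field
    concrete : ConcreteCategory o ℓ
  open ConcreteCategory concrete public
  field
    injective     : ∀ {A B} (f : A ⇒ B) → Injective _≡_ _≡_ ⟦ f ⟧
    bijective⇒iso : ∀ {A B} (f : A ⇒ B) → Bijective _≡_ _≡_ ⟦ f ⟧ →
                    IsIso category f
    transport     : ∀ A {X : Set ℓ} (σ : ∣ A ∣ ⤖ X) →
                    Σ[ Aσ ∈ Obj ] Σ[ eq ∈ ∣ Aσ ∣ ≡ X ] Σ[ σ̄ ∈ A ⇒ Aσ ]
                      (IsIso category σ̄ ×
                       (∀ x → subst (λ Y → Y) eq (⟦ σ̄ ⟧ x) ≡ Bijection.to σ x))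
    fibres-small  : ∀ (X : Set ℓ) →
                    Σ[ S ∈ Set ℓ ] (S ↔ (Σ[ A ∈ Obj ] ∣ A ∣ ≡ X))

-- The full subcategory K_λ.  Its objects carry a chosen injection into λ, so
-- a structure occurs in it in several isomorphic copies; this changes the
-- category only up to equivalence.

module _ {o ℓ : Level} (K : StructureClass o ℓ) (κ : Cardinal ℓ) where
  private module K = StructureClass K

  record BoundedObj : Set (o ⊔ ℓ) where
    field
      obj   : K.Obj
      bound : K.∣ obj ∣ ↣ Cardinal.Carrier κ

  -- A record rather than a synonym, so that A and B can be inferred.

  record BoundedHom (A B : BoundedObj) : Set ℓ where
    constructor bounded
    field
      hom : BoundedObj.obj A K.⇒ BoundedObj.obj B

  open BoundedObj
  open BoundedHom

  infix 9 _↾_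

  _↾_ : ConcreteCategory (o ⊔ ℓ) ℓ
  _↾_ = record
    { category = record
        { Obj       = BoundedObj
        ; _⇒_       = BoundedHom
        ; id        = bounded K.id
        ; _∘_       = λ g f → bounded (hom g K.∘ hom f)
        ; identityˡ = λ f → cong bounded (K.identityˡ (hom f))
        ; identityʳ = λ f → cong bounded (K.identityʳ (hom f))
        ; assoc     = λ h g f → cong bounded (K.assoc (hom h) (hom g) (hom f))
        }
    ; ∣_∣      = λ A → K.∣ obj A ∣
    ; ⟦_⟧      = λ f → K.⟦ hom f ⟧
    ; ⟦id⟧     = K.⟦id⟧
    ; ⟦∘⟧      = λ g f → K.⟦∘⟧ (hom g) (hom f)
    ; faithful = λ e → cong bounded (K.faithful e)
    }

module _ {o ℓ : Level} (C : ConcreteCategory o ℓ) where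
  open ConcreteCategory C

  Coherence : Set (o ⊔ ℓ)
  Coherence = ∀ {A B D} (g : A ⇒ D) (h : B ⇒ D) (f : ∣ A ∣ → ∣ B ∣) →
              (∀ x → ⟦ g ⟧ x ≡ ⟦ h ⟧ (f x)) →
              Σ[ f̄ ∈ A ⇒ B ] (∀ x → ⟦ f̄ ⟧ x ≡ f x)

  record IsSubcanonicalAPClass : Set (o ⊔ suc ℓ) where
    field
      coherence    : Coherence
      amalgamation : AmalgamationProperty category
      subcanonical : Subcanonical (category ᵒᵖ) (Jat (category ᵒᵖ))

  -- The colimit of the carriers is the set of pairs (i , x) with x ∈ ∣ X i ∣
  -- modulo the equivalence generated by (i , x) ↝ (j , step x).

  module _ {δ : Ordinal ℓ} (S : Chain category δ) where
    open Ordinal δ using (Carrier; _<_)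
    open Chain S

    _↝_ : Rel (Σ[ i ∈ Carrier ] ∣ X i ∣) ℓ
    (i , x) ↝ (j , y) = Σ[ p ∈ i < j ] ⟦ step p ⟧ x ≡ y

    canonical : (L : Cocone category S) →
                (Σ[ i ∈ Carrier ] ∣ X i ∣) → ∣ Cocone.apex L ∣
    canonical L (i , x) = ⟦ Cocone.inj L i ⟧ x

    HasConcreteColimit : Set (o ⊔ ℓ)
    HasConcreteColimit =
      Σ[ L ∈ Cocone category S ]
        (IsColimit category L × Bijective (EqClosure _↝_) _≡_ (canonical L))

  TarskiVaught : Cardinal ℓ → Set (o ⊔ suc ℓ)
  TarskiVaught κ =
    ∀ (δ : Ordinal ℓ) → Ordinal.Carrier δ → δ ≤ₒ Cardinal.ordinal κ →
    ∀ (S : Chain category δ) → HasConcreteColimit S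

  record PointedExtension (A : Obj) : Set (o ⊔ ℓ) where
    field
      cod   : Obj
      ext   : A ⇒ cod
      point : ∣ cod ∣

  SameGaloisType : ∀ {A} → Rel (PointedExtension A) (o ⊔ ℓ)
  SameGaloisType p q =
    Σ[ (L , h , k , _) ∈ Amalgamation category (ext p) (ext q) ]
      ⟦ h ⟧ (point p) ≡ ⟦ k ⟧ (point q)
    where
    open PointedExtension

  -- An injection from the Galois types over A into κ, presented as a map on
  -- representatives.

  AtMostGaloisTypes : Cardinal ℓ → Obj → Set (o ⊔ ℓ)
  AtMostGaloisTypes κ A =
    Σ[ τ ∈ (PointedExtension A → Cardinal.Carrier κ) ]
      (Congruent SameGaloisType _≡_ τ × Injective SameGaloisType _≡_ τ)

GaloisStable : ∀ {o ℓ} → StructureClass o ℓ → Cardinal ℓ → Set (o ⊔ ℓ)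
GaloisStable K κ = ∀ A → AtMostGaloisTypes (K ↾ κ) κ A

{-# OPTIONS --safe #-}

-- Write C for K_λ.  By AP and subcanonicity, choice for I-indexed families over
-- Sh(Cᵒᵖ, Jat) says that any family (A → Bᵢ), i ∈ I, in C factors a single A → M: apply
-- choice to the epimorphisms y(Bᵢ) → y(A) and the elements id ∈ y(A)(A) in one direction,
-- and lift local preimages along M in the other.
--
-- If there are more than λ Galois types over A, select λ⁺ inequivalent pointed extensions
-- of A; a common M would contain λ⁺ distinct realizations, contradicting ∣ M ∣ ≤ λ.
--
-- Conversely, stability and λ-TV yield an extension realizing all types over a given
-- structure.  Iterating it λ times over A while amalgamating with each Bᵢ brings
-- every point of Bᵢ into M, and coherence turns this into a morphism Bᵢ → M.

module Submission where

open import Defs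
open import Axiom.ExcludedMiddle using (ExcludedMiddle)
open import Axiom.Extensionality.Propositional
  using (Extensionality; implicit-extensionality)
open import Axiom.UniquenessOfIdentityProofs.WithK using (uip)
open import Data.Bool.Base using (Bool; true; false; not)
open import Data.Empty using (⊥-elim)
open import Data.Product using (Σ; Σ-syntax; ∃; _×_; _,_; proj₁; proj₂)
open import Data.Sum.Base using (_⊎_; inj₁; inj₂; [_,_]; map)
open import Data.Unit.Polymorphic.Base using (⊤; tt)
open import Function.Base using (_∘_; _on_)
open import Function.Bundles using (_↣_; _⇔_; mk↣; mk⇔; module Injection)
open import Function.Definitions using (Congruent; Injective)
open import Induction.WellFounded using (WellFounded; Acc; acc)
open import Level using (Level; _⊔_; suc; Lift; lift; lower)
import Relation.Binary.Construct.On as On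
open import Relation.Binary.Core using (Rel)
open import Relation.Binary.Definitions
  using (Irrelevant; Trichotomous; tri<; tri≈; tri>)
open import Relation.Binary.PropositionalEquality
  using (_≡_; refl; sym; trans; cong; subst)
  renaming (isEquivalence to ≡-isEquivalence)
open import Relation.Binary.Structures using (IsStrictTotalOrder; IsEquivalence)
open import Relation.Nullary using (¬_; Dec; yes; no; does)
open import Relation.Nullary.Decidable using (decidable-stable; recompute)

-- Chains defined by transfinite recursion

module Downsets {ℓ : Level} (κ : Ordinal ℓ) where
  open Ordinal κ
  open IsStrictTotalOrder isStrictTotalOrder using (compare; _<?_; irrefl)
    renaming (trans to <-trans)

  record Downset : Set (suc ℓ) where
    field
      Member : Carrier → Set ℓ
      down   : ∀ {i j} → i < j → Member j → Member i
  open Downset public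

  -- Membership proofs are irrelevant, so that iterated restrictions of chains
  -- agree definitionally.
  record Element (P : Downset) : Set ℓ where
    constructor element
    field
      value   : Carrier
      .member : Member P value
  open Element public

  element-≡ : ∀ {P} {x y : Element P} → value x ≡ value y → x ≡ y
  element-≡ refl = refl

  ↓ : Carrier → Downset
  ↓ k = record { Member = _< k ; down = <-trans }

  full : Downset
  full = record { Member = λ _ → ⊤ ; down = λ _ _ → tt }

  ordinal : Downset → Ordinal ℓ
  ordinal P = record
    { Carrier            = Element P
    ; _<_                = _<_ on value
    ; isStrictTotalOrder = record
        { isStrictPartialOrder = record
            { isEquivalence = ≡-isEquivalence
            ; irrefl        = λ { refl → irrefl refl }
            ; trans         = <-trans
            ; <-resp-≈      = (λ {x} → λ { refl p → p }) , (λ {x} → λ { refl p → p })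
            }
        ; compare = compare′
        }
    ; wellFounded        = On.wellFounded value wellFounded
    ; <-irrelevant       = <-irrelevant
    }
    where
    compare′ : Trichotomous _≡_ (_<_ on value)
    compare′ x y with compare (value x) (value y)
    ... | tri< a b c = tri< a (b ∘ cong value) c
    ... | tri≈ a b c = tri≈ a (element-≡ b) c
    ... | tri> a b c = tri> a (b ∘ cong value) c

  ordinal-≤ : ∀ P → ordinal P ≤ₒ κ
  ordinal-≤ P = record
    { embed   = value
    ; mono    = λ p → p
    ; initial = λ { {element _ m} {y} p → element y (down P p m) , p , refl }
    }

  -- Chain steps need a relevant proof of `<`, while elements store an irrelevant one; decidability
  -- of `<` recovers it.
  below : ∀ {k} (x : Element (↓ k)) → value x < k
  below {k} (element i p) = recompute (i <? k) p

  include : ∀ {P} (k : Element P) → Element (↓ (value k)) → Element P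
  value  (include k x)                                   = value x
  member (include {P} (element _ m) (element _ p)) = down P p m

module ChainRecursion
  (ext : ∀ {a b} → Extensionality a b)
  {ℓ o h : Level} (κ : Ordinal ℓ) (D : Category o h) where
  open Ordinal κ
  open Downsets κ
  open Category D hiding (_∘_)
  open Category D using () renaming (_∘_ to _∙_)
  open Chain
  open Cocone

  -- Objects of two chains are only propositionally equal; bundling a morphism with its endpoints
  -- lets morphisms be compared without transports.
  record Arrow : Set (o ⊔ h) where
    constructor arrow
    field
      {source target} : Obj
      hom             : source ⇒ target

  arrow-injective : ∀ {A B} {f g : A ⇒ B} → arrow f ≡ arrow g → f ≡ g
  arrow-injective refl = refl

  chain-≡ : ∀ {δ : Ordinal ℓ} {S S′ : Chain D δ} → (∀ i → X S i ≡ X S′ i) →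
            (∀ {i j} p → arrow (step S {i} {j} p) ≡ arrow (step S′ p)) → S ≡ S′
  chain-≡ {δ} {S} {S′} eX eS = go (ext eX) eS (step-∘ S) (step-∘ S′)
    where
    module δ = Ordinal δ
    Step : (δ.Carrier → Obj) → Set (ℓ ⊔ h)
    Step Y = ∀ {i j} → i δ.< j → Y i ⇒ Y j
    Functorial : {Y : δ.Carrier → Obj} → Step Y → Set (ℓ ⊔ h)
    Functorial s = ∀ {i j k} (p : i δ.< j) (q : j δ.< k) (r : i δ.< k) →
                   s q ∙ s p ≡ s r
    same : ∀ {Y} {s s′ : Step Y} → (λ {i} {j} → s {i} {j}) ≡ s′ →
           (c : Functorial s) (c′ : Functorial s′) →
           _≡_ {A = Chain D δ} (record { X = Y ; step = s ; step-∘ = c })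
                               (record { X = Y ; step = s′ ; step-∘ = c′ })
    same {Y} {s} refl c c′ =
      cong (λ (c : Functorial s) → record { X = Y ; step = s ; step-∘ = c })
        (implicit-extensionality ext (implicit-extensionality ext
          (implicit-extensionality ext
            (ext λ p → ext λ q → ext λ r → uip (c p q r) (c′ p q r)))))
    go : ∀ {Y Y′} {s : Step Y} {s′ : Step Y′} → Y ≡ Y′ →
         (∀ {i j} (p : i δ.< j) → arrow (s p) ≡ arrow (s′ p)) →
         (c : Functorial s) (c′ : Functorial s′) →
         _≡_ {A = Chain D δ} (record { X = Y ; step = s ; step-∘ = c })
                             (record { X = Y′ ; step = s′ ; step-∘ = c′ })
    go {s = s} {s′} refl e c c′ =
      same {s = s} {s′} (implicit-extensionality ext (implicit-extensionality ext
              (ext λ p → arrow-injective (e p)))) c c′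

  cocone-≡ : ∀ {δ : Ordinal ℓ} {S : Chain D δ} {c c′ : Cocone D S} →
             apex c ≡ apex c′ →
             (∀ i → arrow (inj c i) ≡ arrow (inj c′ i)) → c ≡ c′
  cocone-≡ {δ} {S} {c} {c′} eA eI = go eA eI (commute c) (commute c′)
    where
    module δ = Ordinal δ
    Legs : Obj → Set (ℓ ⊔ h)
    Legs Z = ∀ i → X S i ⇒ Z
    Commutes : ∀ {Z} → Legs Z → Set (ℓ ⊔ h)
    Commutes l = ∀ {i j} (p : i δ.< j) → l j ∙ step S p ≡ l i
    same : ∀ {Z} {l l′ : Legs Z} → l ≡ l′ →
           (c : Commutes l) (c′ : Commutes l′) →
           _≡_ {A = Cocone D S} (record { apex = Z ; inj = l ; commute = c })
                                (record { apex = Z ; inj = l′ ; commute = c′ })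
    same {Z} {l} refl c c′ =
      cong (λ (c : Commutes l) → record { apex = Z ; inj = l ; commute = c })
        (implicit-extensionality ext (implicit-extensionality ext
          (ext λ p → uip (c p) (c′ p))))
    go : ∀ {Z Z′} {l : Legs Z} {l′ : Legs Z′} → Z ≡ Z′ →
         (∀ i → arrow (l i) ≡ arrow (l′ i)) →
         (c : Commutes l) (c′ : Commutes l′) →
         _≡_ {A = Cocone D S} (record { apex = Z ; inj = l ; commute = c })
                              (record { apex = Z′ ; inj = l′ ; commute = c′ })
    go refl e = same (ext λ i → arrow-injective (e i))

  ChainOn : Downset → Set (o ⊔ h ⊔ ℓ)
  ChainOn P = Chain D (ordinal P)

  restrict : ∀ {P} → ChainOn P → (k : Element P) → ChainOn (↓ (value k))
  restrict {P} S k = record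
    { X      = λ x → X S (include k x)
    ; step   = step S
    ; step-∘ = step-∘ S
    }

  coconeAt : ∀ {P} (S : ChainOn P) k → Cocone D (restrict S k)
  coconeAt S k = record
    { apex    = X S k
    ; inj     = λ x → step S (below x)
    ; commute = λ p → step-∘ S _ _ _
    }

  ConedChain : Carrier → Set (o ⊔ h ⊔ ℓ)
  ConedChain k = Σ (ChainOn (↓ k)) (Cocone D)

  coned-≡ : ∀ {k} {e e′ : ConedChain k} → proj₁ e ≡ proj₁ e′ →
            apex (proj₂ e) ≡ apex (proj₂ e′) →
            (∀ i → arrow (inj (proj₂ e) i) ≡ arrow (inj (proj₂ e′) i)) → e ≡ e′
  coned-≡ refl eA eI = cong (_ ,_) (cocone-≡ eA eI)

  at : ∀ {P} → ChainOn P → (k : Element P) → ConedChain (value k)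
  at S k = restrict S k , coconeAt S k

  -- A coned chain of shape ↓ k serves as a chain of shape { j ∣ j ≤ k }.
  cut : ∀ {k} → ConedChain k → (j : Element (↓ k)) → ConedChain (value j)
  cut (T , _) j = at T j

  module Glue {P : Downset} (E : (k : Element P) → ConedChain (value k))
    (compatible : ∀ (j k : Element P) (p : value j < value k) →
                  cut (E k) (element (value j) p) ≡ E j) where

    vertex : ∀ {k} → ConedChain k → Obj
    vertex (_ , c) = apex c

    -- The leg at `j` starts at the vertex of the cut; matching on the equation moves its source to
    -- the vertex of the separately given `e′`.
    link : ∀ {k} (e : ConedChain k) j {e′ : ConedChain (value j)} →
           cut e j ≡ e′ → vertex e′ ⇒ vertex e
    link (_ , c) j refl = inj c j

    link-∘ : ∀ {i j k} (p : i < j) (q : j < k) (r : i < k)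
             (e : ConedChain k) {e′ : ConedChain j} {e″ : ConedChain i}
             (u : cut e (element j q) ≡ e′) (v : cut e′ (element i p) ≡ e″)
             (w : cut e (element i r) ≡ e″) →
             link e (element j q) u ∙ link e′ (element i p) v ≡
             link e (element i r) w
    link-∘ p q r (T , c) refl refl refl = commute c _

    glue : ChainOn P
    glue = record
      { X      = λ k → vertex (E k)
      ; step   = λ {j} {k} p → link (E k) (element (value j) p) (compatible j k p)
      ; step-∘ = λ {i} {j} {k} p q r → link-∘ p q r (E k)
                   (compatible j k q) (compatible i j p) (compatible i k r)
      }

    vertex-cut : ∀ {k j} (e : ConedChain k) {e′ : ConedChain (value j)} →
                 cut e j ≡ e′ → vertex e′ ≡ X (proj₁ e) j
    vertex-cut e refl = refl

    step-cut : ∀ {i j k} (p : i < j) .(q : j < k) .(r : i < k)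
               (e : ConedChain k) {e′ : ConedChain j} {e″ : ConedChain i}
               (u : cut e (element j q) ≡ e′) (v : cut e′ (element i p) ≡ e″)
               (w : cut e (element i r) ≡ e″) →
               arrow (link e′ (element i p) v) ≡
               arrow (step (proj₁ e) {element i r} {element j q} p)
    step-cut {i} {j} p q r (T , c) refl refl refl =
      cong (λ p → arrow (step T {element i r} {element j q} p)) (<-irrelevant _ _)

    leg-cut : ∀ {k j} (e : ConedChain k) {e′ : ConedChain (value j)} →
              (u : cut e j ≡ e′) → arrow (link e j u) ≡ arrow (inj (proj₂ e) j)
    leg-cut e refl = refl

    -- By compatibility the chain inside `E k` already has the vertices and links of the earlier
    -- stages. This equation transfers to `glue` whatever is known of each `E k`.
    at-glue : ∀ k → at glue k ≡ E k
    at-glue k = coned-≡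
      (chain-≡ (λ j → vertex-cut (E k) (cut-below j))
               (λ {i} {j} p → step-cut p (below j) (below i) (E k)
                  (cut-below j) (compatible (include k i) (include k j) p)
                  (cut-below i)))
      refl
      (λ j → leg-cut (E k) (compatible (include k j) k (below j)))
      where
      cut-below : ∀ j → cut (E k) j ≡ E (include k j)
      cut-below j = compatible (include k j) k (below j)

  module _ (F : ∀ k (S : ChainOn (↓ k)) → Cocone D S) where

    Follows : ∀ {k} → ConedChain k → Set (o ⊔ h ⊔ ℓ)
    Follows {k} (S , c) = c ≡ F k S

    -- These are the partial solutions of the recursion with rule `F`, the "attempts" of the usual
    -- recursion theorem.
    Good : ∀ {P} → ChainOn P → Set (o ⊔ h ⊔ ℓ)
    Good S = ∀ k → Follows (at S k)

    restrict-good : ∀ {P} (S : ChainOn P) k → Good S → Good (restrict S k)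
    restrict-good S k g j = g (include k j)

    -- By induction the two chains agree below each `j`, so `F` prescribes the same vertex and legs
    -- at `j`; every step of a chain is such a leg.
    good-unique′ : ∀ {k} → Acc _<_ k → (S S′ : ChainOn (↓ k)) →
                   Good S → Good S′ → S ≡ S′
    good-unique′ (acc rs) S S′ g g′ =
      chain-≡ (λ j → cong (λ e → apex (proj₂ e)) (same j))
              (λ {i} {j} p → trans (leg S p) (trans
                (cong (λ e → arrow (inj (proj₂ e) (element (value i) p))) (same j))
                (sym (leg S′ p))))
      where
      follow : ∀ {j} {T T′ : ChainOn (↓ j)} {c : Cocone D T} {c′ : Cocone D T′} →
               T ≡ T′ → Follows (T , c) → Follows (T′ , c′) → (T , c) ≡ (T′ , c′)
      follow refl refl refl = refl
      same : ∀ j → at S j ≡ at S′ j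
      same j = follow
        (good-unique′ (rs (below j)) (restrict S j) (restrict S′ j)
          (restrict-good S j g) (restrict-good S′ j g′))
        (g j) (g′ j)
      leg : ∀ T {i j} (p : value i < value j) →
            arrow (step T {i} {j} p) ≡
            arrow (inj (proj₂ (at T j)) (element (value i) p))
      leg T {i} {j} p = cong (λ p → arrow (step T {i} {j} p)) (<-irrelevant _ _)

    module _ {P : Downset}
      (T : (k : Element P) → ChainOn (↓ (value k))) (g : ∀ k → Good (T k)) where

      -- Uniqueness makes the partial solutions cohere, so after each is capped with the cocone from
      -- `F` they can be glued; `at-glue` shows that the result follows `F`.
      good-glue : Σ (ChainOn P) Good
      good-glue = glue , λ k → subst Follows (sym (at-glue k)) refl
        where
        compatible : ∀ (j k : Element P) (p : value j < value k) →
                     at (T k) (element (value j) p) ≡ (T j , F (value j) (T j))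
        compatible j k p = lemma
          (good-unique′ (wellFounded (value j)) _ _
            (restrict-good (T k) (element (value j) p) (g k)) (g j))
          (g k (element (value j) p))
          where
          lemma : ∀ {i} {S S′ : ChainOn (↓ i)} {c : Cocone D S} →
                  S ≡ S′ → Follows (S , c) → (S , c) ≡ (S′ , F i S′)
          lemma refl refl = refl
        open Glue {P} (λ k → T k , F (value k) (T k)) compatible

    good-exists′ : ∀ {k} → Acc _<_ k → Σ (ChainOn (↓ k)) Good
    good-exists′ (acc rs) = good-glue (λ j → proj₁ (ih j)) (λ j → proj₂ (ih j))
      where
      ih : ∀ j → Σ (ChainOn (↓ (value j))) Good
      ih j = good-exists′ (rs (below j))

    good-exists : ∀ P → Σ (ChainOn P) Good
    good-exists P = good-glue (λ k → proj₁ (ih k)) (λ k → proj₂ (ih k))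
      where
      ih : ∀ k → Σ (ChainOn (↓ (value k))) Good
      ih k = good-exists′ (wellFounded (value k))

-- Generic extensions along chains

HasCocones : ∀ {o h ℓ} → Category o h → Ordinal ℓ → Set (o ⊔ h ⊔ suc ℓ)
HasCocones {ℓ = ℓ} D κ =
  ∀ (δ : Ordinal ℓ) → Ordinal.Carrier δ → δ ≤ₒ κ → (S : Chain D δ) → Cocone D S

module Coslice {o h : Level} (D : Category o h) (A : Category.Obj D) where
  open Category D renaming (_∘_ to _∙_)
  open Chain
  open Cocone

  under-≡ : ∀ {X Y} {x : A ⇒ X} {y : A ⇒ Y} {f g : X ⇒ Y} {p : f ∙ x ≡ y}
            {q : g ∙ x ≡ y} → f ≡ g →
            _≡_ {A = Σ[ f ∈ X ⇒ Y ] f ∙ x ≡ y} (f , p) (g , q)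
  under-≡ {f = f} {p = p} {q} refl = cong (f ,_) (uip p q)

  coslice : Category (o ⊔ h) h
  coslice = record
    { Obj       = Σ[ X ∈ Obj ] A ⇒ X
    ; _⇒_       = λ (X , x) (Y , y) → Σ[ f ∈ X ⇒ Y ] f ∙ x ≡ y
    ; id        = id , identityˡ _
    ; _∘_       = λ (g , q) (f , p) →
                    g ∙ f , trans (assoc _ _ _) (trans (cong (g ∙_) p) q)
    ; identityˡ = λ f → under-≡ (identityˡ _)
    ; identityʳ = λ f → under-≡ (identityʳ _)
    ; assoc     = λ h g f → under-≡ (assoc _ _ _)
    }

  module _ {ℓ : Level} {δ : Ordinal ℓ} where
    open Ordinal δ

    forget : Chain coslice δ → Chain D δ
    forget S = record
      { X      = λ i → proj₁ (X S i)
      ; step   = λ p → proj₁ (step S p)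
      ; step-∘ = λ p q r → cong proj₁ (step-∘ S p q r)
      }

    -- The index `i₀` supplies the structure map from `A`. Indices are pairwise comparable, so every
    -- other index gives the same composite.
    coslice-cocone : (S : Chain coslice δ) → Carrier → Cocone D (forget S) →
                     Cocone coslice S
    coslice-cocone S i₀ L = record
      { apex    = apex L , inj L i₀ ∙ proj₂ (X S i₀)
      ; inj     = λ i → inj L i , same i
      ; commute = λ p → under-≡ (commute L p)
      }
      where
      later : ∀ {i j} → i < j → inj L j ∙ proj₂ (X S j) ≡ inj L i ∙ proj₂ (X S i)
      later {i} {j} p = trans (cong (inj L j ∙_) (sym (proj₂ (step S p))))
        (trans (sym (assoc _ _ _)) (cong (_∙ proj₂ (X S i)) (commute L p)))
      same : ∀ i → inj L i ∙ proj₂ (X S i) ≡ inj L i₀ ∙ proj₂ (X S i₀)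
      same i with IsStrictTotalOrder.compare isStrictTotalOrder i i₀
      ... | tri< p _ _    = sym (later p)
      ... | tri≈ _ refl _ = refl
      ... | tri> _ _ p    = later p

module _ {o h ℓ : Level} {D : Category o h} {δ : Ordinal ℓ} {S : Chain D δ} where
  open Category D renaming (_∘_ to _∙_)
  open Cocone

  extend-cocone : (L : Cocone D S) → ∀ {Z} → apex L ⇒ Z → Cocone D S
  extend-cocone L f = record
    { apex    = _
    ; inj     = λ i → f ∙ inj L i
    ; commute = λ p → trans (assoc _ _ _) (cong (f ∙_) (commute L p))
    }

module _ (em : ∀ {a} → ExcludedMiddle a) (ext : ∀ {a b} → Extensionality a b)
  {ℓ o h : Level} (κ : Ordinal ℓ) (D : Category o h) where
  open Category D renaming (_∘_ to _∙_)
  open Ordinal κ using (Carrier)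

  abstract
    -- A Baire category argument: the i-th object of the chain is an extension in
    -- P i of a cocone over the preceding ones.
    generic-arrow : ∀ {p} → HasCocones D κ → Carrier → ∀ A
      (P : Carrier → ∀ {X} → A ⇒ X → Set p) →
      (∀ i {X} (x : A ⇒ X) → Σ[ Y ∈ Obj ] Σ[ s ∈ X ⇒ Y ] P i (s ∙ x)) →
      (∀ i {X Y} (t : X ⇒ Y) (x : A ⇒ X) → P i x → P i (t ∙ x)) →
      Σ[ Z ∈ Obj ] Σ[ z ∈ A ⇒ Z ] ∀ i → P i z
    generic-arrow cocones i₀ A P dense closed = proj₁ (apex L) , proj₂ (apex L) , holds
      where
      open Downsets κ
      open Coslice D A
      open ChainRecursion ext κ coslice
      open Cocone

      base : ∀ k (S : ChainOn (↓ k)) → Cocone coslice S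
      base k S with em {P = Element (↓ k)}
      ... | yes i = coslice-cocone S i (cocones _ i (ordinal-≤ (↓ k)) (forget S))
      -- `cocones` covers nonempty chains only; over the empty chain the construction starts from
      -- `A` itself.
      ... | no ¬i = record
        { apex    = A , id
        ; inj     = λ i → ⊥-elim (¬i i)
        ; commute = λ {i} → ⊥-elim (¬i i)
        }

      F : ∀ k (S : ChainOn (↓ k)) → Cocone coslice S
      F k S = extend-cocone (base k S)
        (proj₁ (proj₂ (dense k (proj₂ (apex (base k S))))) , refl)

      S : ChainOn full
      S = proj₁ (good-exists F full)

      L : Cocone coslice S
      L = coslice-cocone S i (cocones _ i (ordinal-≤ full) (forget S))
        where
        i : Element full
        i = element i₀ tt

      holds : ∀ i → P i (proj₂ (apex L))
      -- Goodness identifies stage `i` with the extension made by `dense`, so `P i` holds there;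
      -- `closed` carries it along the leg into the apex of `L`.
      holds i = subst (P i) (proj₂ (inj L k))
        (closed i (proj₁ (inj L k)) (proj₂ (Chain.X S k))
          (subst (λ c → P i (proj₂ (apex c))) (sym (proj₂ (good-exists F full) k))
            (proj₂ (proj₂ (dense i (proj₂ (apex (base i (restrict S k)))))))))
        where
        k : Element full
        k = element i tt

-- Galois types and universal extensions

module ArrowFamilies (ext : ∀ {a b} → Extensionality a b)
  {o h i : Level} (C : Category o h) (I : Set i) where
  open Category C renaming (_∘_ to _∙_)

  -- Taking these as objects lets `generic-arrow` grow one source and all the targets in a single
  -- chain.
  record ArrowFamily : Set (o ⊔ h ⊔ i) where
    constructor family
    field
      {src} : Obj
      {tgt} : I → Obj
      hom   : ∀ i → src ⇒ tgt i
  open ArrowFamily public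

  record Squares (X Y : ArrowFamily) : Set (h ⊔ i) where
    constructor squares
    field
      top      : src X ⇒ src Y
      bottom   : ∀ i → tgt X i ⇒ tgt Y i
      commutes : ∀ i → bottom i ∙ hom X i ≡ hom Y i ∙ top
  open Squares public

  squares-≡ : ∀ {X Y} {α β : Squares X Y} → top α ≡ top β →
              (∀ i → bottom α i ≡ bottom β i) → α ≡ β
  squares-≡ {X} {Y} {α} {β} e d = go e (ext d) (commutes α) (commutes β)
    where
    Commutes : src X ⇒ src Y → (∀ i → tgt X i ⇒ tgt Y i) → Set (h ⊔ i)
    Commutes t b = ∀ i → b i ∙ hom X i ≡ hom Y i ∙ t
    go : ∀ {t t′ b b′} → t ≡ t′ → b ≡ b′ →
         (c : Commutes t b) (c′ : Commutes t′ b′) →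
         _≡_ {A = Squares X Y} (squares t b c) (squares t′ b′ c′)
    go refl refl c c′ = cong (squares _ _) (ext λ i → uip (c i) (c′ i))

  paste : ∀ {A B D A′ B′ D′} {f : A ⇒ A′} {g : B ⇒ B′} {k : D ⇒ D′}
          {s : A ⇒ B} {t : B ⇒ D} {s′ : A′ ⇒ B′} {t′ : B′ ⇒ D′} →
          t′ ∙ g ≡ k ∙ t → s′ ∙ f ≡ g ∙ s → (t′ ∙ s′) ∙ f ≡ k ∙ (t ∙ s)
  paste {s = s} {t′ = t′} p q = trans (assoc _ _ _) (trans (cong (t′ ∙_) q)
    (trans (sym (assoc _ _ _)) (trans (cong (_∙ s) p) (assoc _ _ _))))

  arrowFamilies : Category (o ⊔ h ⊔ i) (h ⊔ i)
  arrowFamilies = record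
    { Obj       = ArrowFamily
    ; _⇒_       = Squares
    ; id        = squares id (λ _ → id)
                    (λ _ → trans (identityˡ _) (sym (identityʳ _)))
    ; _∘_       = λ β α → squares (top β ∙ top α) (λ i → bottom β i ∙ bottom α i)
                    (λ i → paste (commutes β i) (commutes α i))
    ; identityˡ = λ _ → squares-≡ (identityˡ _) (λ _ → identityˡ _)
    ; identityʳ = λ _ → squares-≡ (identityʳ _) (λ _ → identityʳ _)
    ; assoc     = λ _ _ _ → squares-≡ (assoc _ _ _) (λ _ → assoc _ _ _)
    }

  -- Colimits are formed separately for the sources and for each target; the universal property of
  -- the source colimit then induces the arrows between the apexes.
  arrowFamilies-cocones : ∀ {ℓ} {κ : Ordinal ℓ} →
    (∀ δ → Ordinal.Carrier δ → δ ≤ₒ κ → (S : Chain C δ) →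
      Σ (Cocone C S) (IsColimit C)) →
    HasCocones arrowFamilies κ
  arrowFamilies-cocones colimit δ i₀ δ≤κ S = record
    { apex    = family (λ i → proj₁ (induced i))
    ; inj     = λ j → squares (inj M j) (λ i → inj (N i) j)
                        (λ i → sym (proj₁ (proj₂ (induced i)) j))
    ; commute = λ p → squares-≡ (commute M p) (λ i → commute (N i) p)
    }
    where
    open Chain
    open Cocone
    srcs : Chain C δ
    srcs = record
      { X      = λ j → src (X S j)
      ; step   = λ p → top (step S p)
      ; step-∘ = λ p q r → cong top (step-∘ S p q r)
      }
    tgts : I → Chain C δ
    tgts i = record
      { X      = λ j → tgt (X S j) i
      ; step   = λ p → bottom (step S p) i
      ; step-∘ = λ p q r → cong (λ α → bottom α i) (step-∘ S p q r)
      }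
    M : Cocone C srcs
    M = proj₁ (colimit δ i₀ δ≤κ srcs)
    N : ∀ i → Cocone C (tgts i)
    N i = proj₁ (colimit δ i₀ δ≤κ (tgts i))
    induced : ∀ i → Σ[ u ∈ apex M ⇒ apex (N i) ]
                ((∀ j → u ∙ inj M j ≡ inj (N i) j ∙ hom (X S j) i) × _)
    induced i = proj₂ (colimit δ i₀ δ≤κ srcs) (record
      { apex    = apex (N i)
      ; inj     = λ j → inj (N i) j ∙ hom (X S j) i
      ; commute = λ {j} {k} p → trans (assoc _ _ _)
          (trans (cong (inj (N i) k ∙_) (sym (commutes (step S p) i)))
          (trans (sym (assoc _ _ _))
                 (cong (_∙ hom (X S j) i) (commute (N i) p))))
      })

module GaloisTypes {o ℓ : Level} (C : ConcreteCategory o ℓ)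
  (amalgamation : AmalgamationProperty (ConcreteCategory.category C)) where
  open ConcreteCategory C renaming (_∘_ to _∙_)
  open PointedExtension

  -- For transitivity, both amalgams receive the codomain of the middle extension; amalgamating them
  -- over it makes all three points agree.
  sameType-isEquivalence : ∀ {A} → IsEquivalence (SameGaloisType C {A})
  sameType-isEquivalence = record
    { refl  = λ {p} → (cod p , id , id , refl) , refl
    ; sym   = λ ((D , h , k , e) , e′) → (D , k , h , sym e) , sym e′
    ; trans = sameType-trans
    }
    where
    sameType-trans : ∀ {p q r} → SameGaloisType C p q → SameGaloisType C q r →
                     SameGaloisType C p r
    sameType-trans {q = q} ((D , h , k , e) , e₁) ((D′ , h′ , k′ , e′) , e₂) =
      let (E , u , v , uk≡vh′) = amalgamation k h′ in
      (E , u ∙ h , v ∙ k′ , square e uk≡vh′ e′)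
      , trans (⟦∘⟧ _ _ _) (trans (cong ⟦ u ⟧ e₁) (trans (sym (⟦∘⟧ _ _ _))
          (trans (cong (λ f → ⟦ f ⟧ (point q)) uk≡vh′) (trans (⟦∘⟧ _ _ _)
          (trans (cong ⟦ v ⟧ e₂) (sym (⟦∘⟧ _ _ _)))))))
      where
      square : ∀ {A P Q R D D′ E} {f : A ⇒ P} {g : A ⇒ Q} {l : A ⇒ R}
               {h : P ⇒ D} {k : Q ⇒ D} {h′ : Q ⇒ D′} {k′ : R ⇒ D′}
               {u : D ⇒ E} {v : D′ ⇒ E} →
               h ∙ f ≡ k ∙ g → u ∙ k ≡ v ∙ h′ → h′ ∙ g ≡ k′ ∙ l →
               (u ∙ h) ∙ f ≡ (v ∙ k′) ∙ l
      square {g = g} {u = u} {v} p q r =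
        trans (assoc _ _ _) (trans (cong (u ∙_) p) (trans (sym (assoc _ _ _))
          (trans (cong (_∙ g) q) (trans (assoc _ _ _)
          (trans (cong (v ∙_) r) (sym (assoc _ _ _)))))))

  module _ {A : Obj} where
    open IsEquivalence (sameType-isEquivalence {A}) public
      using () renaming (trans to sameType-trans)

module Stable (em : ∀ {a} → ExcludedMiddle a) (funext : ∀ {a b} → Extensionality a b)
  {o ℓ : Level} (C : ConcreteCategory o ℓ) (κ : Cardinal ℓ) where
  open ConcreteCategory C renaming (_∘_ to _∙_)
  open Cardinal κ using (Carrier; ordinal)
  open PointedExtension

  module _
    (inhabitant   : Carrier)
    (⟦⟧-injective : ∀ {A B} (f : A ⇒ B) → Injective _≡_ _≡_ ⟦ f ⟧)
    (small        : ∀ A → ∣ A ∣ ↣ Carrier)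
    (coherence    : Coherence C)
    (amalgamation : AmalgamationProperty category)
    (tarskiVaught : TarskiVaught C κ)
    (stable       : ∀ A → AtMostGaloisTypes C κ A) where
    open GaloisTypes C amalgamation

    RealizesTypes : ∀ {A B} → A ⇒ B → Set (o ⊔ ℓ)
    RealizesTypes {A} {B} f = ∀ (p : PointedExtension C A) →
      Σ[ c ∈ ∣ B ∣ ] SameGaloisType C p (record { cod = B ; ext = f ; point = c })

    abstract
      -- Stability codes the types by elements of `κ`, which gives `generic-arrow` one requirement
      -- for each `α`: realize the type coded by `α`.
      type-realizing : ∀ A → Σ[ B ∈ Obj ] Σ[ f ∈ A ⇒ B ] RealizesTypes f
      type-realizing A =
        let (Z , z , realized) = generic-arrow em funext ordinal category
              (λ δ i δ≤κ S → proj₁ (tarskiVaught δ i δ≤κ S))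
              inhabitant A Realizes dense closed
        in Z , z , λ p → realized (τ p) p refl
        where
        τ : PointedExtension C A → Carrier
        τ = proj₁ (stable A)
        Realizes : Carrier → ∀ {X} → A ⇒ X → Set (o ⊔ ℓ)
        Realizes α {X} x = ∀ p → τ p ≡ α →
          Σ[ c ∈ ∣ X ∣ ] SameGaloisType C p (record { cod = X ; ext = x ; point = c })
        dense : ∀ α {X} (x : A ⇒ X) → Σ[ Y ∈ Obj ] Σ[ s ∈ X ⇒ Y ] Realizes α (s ∙ x)
        dense α {X} x with em {P = Σ[ p ∈ PointedExtension C A ] τ p ≡ α}
        ... | no ¬p = X , id , λ p e → ⊥-elim (¬p (p , e))
        ... | yes (p , τp≡α) with amalgamation x (ext p)
        -- Any `q` with code `α` has the same type as `p`, so one realization serves for all of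
        -- them.
        ... | D , s , k , e = D , s , λ q τq≡α → ⟦ k ⟧ (point p) ,
          sameType-trans (proj₂ (proj₂ (stable A)) (trans τq≡α (sym τp≡α)))
            ((D , k , id , trans (sym e) (sym (identityˡ _))) , sym (⟦id⟧ _))
        closed : ∀ α {X Y} (t : X ⇒ Y) (x : A ⇒ X) → Realizes α x → Realizes α (t ∙ x)
        closed α {Y = Y} t x r p e = ⟦ t ⟧ (proj₁ (r p e)) ,
          sameType-trans (proj₂ (r p e))
            ((Y , t , id , sym (identityˡ _)) , sym (⟦id⟧ _))
    -- Each Bᵢ is amalgamated with a growing extension M of A into Nᵢ; at stage α the
    -- α-th point of Bᵢ is brought into M.  In the end Bᵢ → Nᵢ factors through M.
    universal-extension : ∀ {I : Set ℓ} {A} {B : I → Obj} (f : ∀ i → A ⇒ B i) →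
      Σ[ M ∈ Obj ] Σ[ z ∈ A ⇒ M ] ∀ i → Σ[ u ∈ B i ⇒ M ] u ∙ f i ≡ z
    universal-extension {I} {A} {B} f = factors
      (generic-arrow em funext ordinal arrowFamilies
        (arrowFamilies-cocones {κ = ordinal} (λ δ i δ≤κ S →
          proj₁ (tarskiVaught δ i δ≤κ S) , proj₁ (proj₂ (tarskiVaught δ i δ≤κ S))))
        inhabitant start Absorbs dense closed)
      where
      open ArrowFamilies funext category I
      open Category arrowFamilies using () renaming (_∘_ to _⊙_)
      start : ArrowFamily
      start = family f
      index : ∀ i → ∣ B i ∣ → Carrier
      index i = Injection.to (small (B i))
      Absorbs : Carrier → ∀ {X} → Squares start X → Set ℓ
      Absorbs α {X} x = ∀ i b → index i b ≡ α →
        Σ[ c ∈ ∣ src X ∣ ] ⟦ hom X i ⟧ c ≡ ⟦ bottom x i ⟧ b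
      closed : ∀ α {X Y} (t : Squares X Y) (x : Squares start X) →
               Absorbs α x → Absorbs α (t ⊙ x)
      closed α t x a i b e = ⟦ top t ⟧ (proj₁ (a i b e)) ,
        trans (sym (⟦∘⟧ _ _ _)) (trans (cong (λ f → ⟦ f ⟧ (proj₁ (a i b e)))
          (sym (commutes t i))) (trans (⟦∘⟧ _ _ _)
          (trans (cong ⟦ bottom t i ⟧ (proj₂ (a i b e))) (sym (⟦∘⟧ _ _ _)))))
      dense : ∀ α {X} (x : Squares start X) →
              Σ[ Y ∈ ArrowFamily ] Σ[ s ∈ Squares X Y ] Absorbs α (s ⊙ x)
      dense α {X} x = absorb (type-realizing (src X))
        where
        absorb : (Σ[ M′ ∈ Obj ] Σ[ r ∈ src X ⇒ M′ ] RealizesTypes r) →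
                 Σ[ Y ∈ ArrowFamily ] Σ[ s ∈ Squares X Y ] Absorbs α (s ⊙ x)
        absorb (M′ , r , realizes) = family (λ i → proj₁ (proj₂ (proj₂ (step i em))))
          , squares r (λ i → proj₁ (proj₂ (step i em)))
                      (λ i → proj₁ (proj₂ (proj₂ (proj₂ (step i em)))))
          , λ i → proj₂ (proj₂ (proj₂ (proj₂ (step i em))))
          where
          step : ∀ i → Dec (Σ[ b ∈ ∣ B i ∣ ] index i b ≡ α) →
                 Σ[ N ∈ Obj ] Σ[ b′ ∈ tgt X i ⇒ N ] Σ[ m ∈ M′ ⇒ N ]
                   (b′ ∙ hom X i ≡ m ∙ r) × (∀ b → index i b ≡ α →
                     Σ[ c ∈ ∣ M′ ∣ ] ⟦ m ⟧ c ≡ ⟦ b′ ∙ bottom x i ⟧ b)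
          -- No point has index `α`, so any amalgam will do.
          step i (no ¬b) =
            let (N , b′ , m , e) = amalgamation (hom X i) r
            in N , b′ , m , e , λ b p → ⊥-elim (¬b (b , p))
          -- The type over `src X` of the image of `b` is realized by some `c` in `M′`. The amalgam
          -- witnessing this identifies `c` with that image, so it is taken as the new target.
          -- Injectivity of `index i` leaves no other point to absorb.
          step i (yes (b , p)) =
            let (c , (N , b′ , m , e) , e′) = realizes
                  (record { cod = tgt X i ; ext = hom X i ; point = ⟦ bottom x i ⟧ b })
            in N , b′ , m , e , λ b₁ p₁ → c ,
               trans (sym e′) (trans (sym (⟦∘⟧ _ _ _)) (cong ⟦ b′ ∙ bottom x i ⟧
                 (Injection.injective (small (B i)) (trans p (sym p₁)))))
      factors : (Σ[ Z ∈ ArrowFamily ] Σ[ z ∈ Squares start Z ] ∀ α → Absorbs α z) →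
                Σ[ M ∈ Obj ] Σ[ z ∈ A ⇒ M ] ∀ i → Σ[ u ∈ B i ⇒ M ] u ∙ f i ≡ z
      factors (Z , z , absorbs) = src Z , top z , λ i → factor i , factor-∙ i
        where
        absorbed : ∀ i b → Σ[ c ∈ ∣ src Z ∣ ] ⟦ hom Z i ⟧ c ≡ ⟦ bottom z i ⟧ b
        absorbed i b = absorbs (index i b) i b refl
        lift-factor : ∀ i → Σ[ u ∈ B i ⇒ src Z ] (∀ b → ⟦ u ⟧ b ≡ proj₁ (absorbed i b))
        lift-factor i = coherence (bottom z i) (hom Z i) (λ b → proj₁ (absorbed i b))
          (λ b → sym (proj₂ (absorbed i b)))
        factor : ∀ i → B i ⇒ src Z
        factor i = proj₁ (lift-factor i)
        factor-∙ : ∀ i → factor i ∙ f i ≡ top z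
        -- The triangle commutes after composition with the embedding `hom Z i`, which is then
        -- cancelled pointwise.
        factor-∙ i = faithful λ a → ⟦⟧-injective (hom Z i)
          (trans (cong ⟦ hom Z i ⟧ (trans (⟦∘⟧ _ _ _) (proj₂ (lift-factor i) _)))
          (trans (proj₂ (absorbed i (⟦ f i ⟧ a))) (trans (sym (⟦∘⟧ _ _ _))
          (trans (cong (λ g → ⟦ g ⟧ a) (commutes z i)) (⟦∘⟧ _ _ _)))))

-- The least cardinal above a given one

module Classical (em : ∀ {a} → ExcludedMiddle a) where

  -- `Bool` is small whatever the level of `A`, so truth values of large propositions can serve as
  -- small, proof-irrelevant data.
  ⌊_⌋ : ∀ {a} → Set a → Bool
  ⌊ A ⌋ = does (em {P = A})

  module _ {a : Level} {A : Set a} where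

    holds⇒true : A → ⌊ A ⌋ ≡ true
    holds⇒true x with em {P = A}
    ... | yes _ = refl
    ... | no ¬x = ⊥-elim (¬x x)

    fails⇒false : ¬ A → ⌊ A ⌋ ≡ false
    fails⇒false ¬x with em {P = A}
    ... | yes x = ⊥-elim (¬x x)
    ... | no _  = refl

    true⇒holds : ⌊ A ⌋ ≡ true → A
    true⇒holds e with em {P = A}
    ... | yes x = x

    false⇒fails : ⌊ A ⌋ ≡ false → ¬ A
    false⇒fails e x with em {P = A}
    ... | no ¬x = ¬x x

  ⌊⌋-cong : ∀ {a b} {A : Set a} {B : Set b} → (A → B) → (B → A) → ⌊ A ⌋ ≡ ⌊ B ⌋
  ⌊⌋-cong {A = A} f g with em {P = A}
  ... | yes x = sym (holds⇒true (f x))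
  ... | no ¬x = sym (fails⇒false (¬x ∘ g))

  by-contradiction : ∀ {a} {A : Set a} → ¬ ¬ A → A
  by-contradiction = decidable-stable em

  -- The element found depends on the subset only, not on the proof that it is nonempty.
  choose : ∀ {v} {V : Set v} (S : V → Bool) → ∃ (λ v → S v ≡ true) → V
  choose S nonempty with em {P = ∃ λ v → S v ≡ true}
  ... | yes (v , _)   = v
  ... | no ¬nonempty = ⊥-elim (¬nonempty nonempty)

  choose-∈ : ∀ {v} {V : Set v} (S : V → Bool) ne → S (choose S ne) ≡ true
  choose-∈ S nonempty with em {P = ∃ λ v → S v ≡ true}
  ... | yes (_ , e)   = e
  ... | no ¬nonempty = ⊥-elim (¬nonempty nonempty)

  choose-cong : ∀ {v} {V : Set v} {S S′ : V → Bool} → S ≡ S′ →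
                ∀ ne ne′ → choose S ne ≡ choose S′ ne′
  choose-cong {S = S} refl ne ne′ with em {P = ∃ λ v → S v ≡ true}
  ... | yes _         = refl
  ... | no ¬nonempty = ⊥-elim (¬nonempty ne)

SmallSegment : ∀ {w r ℓ} {W : Set w} → Rel W r → Set ℓ → W → Set (w ⊔ r ⊔ ℓ)
SmallSegment {W = W} _<_ C w =
  Σ[ g ∈ (∀ v → v < w → C) ] (∀ {v v′ p p′} → g v p ≡ g v′ p′ → v ≡ v′)

module Selection (em : ∀ {a} → ExcludedMiddle a) (ext : ∀ {a b} → Extensionality a b)
  {a r t q ℓ : Level} {W : Set a} {_<_ : Rel W r} {T : Set t} {_~_ : Rel T q} {C : Set ℓ}
  (wellFounded : WellFounded _<_)
  (<-irrelevant : Irrelevant _<_)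
  (connected : ∀ {v w} → ¬ v ≡ w → v < w ⊎ w < v)
  (small : ∀ w → SmallSegment _<_ C w)
  (isEquivalence : IsEquivalence _~_)
  (many : ¬ (Σ[ τ ∈ (T → C) ] (Congruent _~_ _≡_ τ × Injective _~_ _≡_ τ))) where
  open Classical em
  open IsEquivalence isEquivalence using () renaming (sym to ~-sym; trans to ~-trans)

  -- If every class were hit by some `f v p`, sending a class to such a `v` and then into `C` by
  -- `small w` would contradict `many`.
  fresh : ∀ w (f : ∀ v → v < w → T) → Σ[ t ∈ T ] (∀ v p → ¬ f v p ~ t)
  fresh w f = by-contradiction λ none → many (covered λ t →
    by-contradiction λ ¬hit → none (t , λ v p e → ¬hit (v , p , e)))
    where
    covered : (∀ t → Σ[ v ∈ W ] Σ[ p ∈ v < w ] f v p ~ t) →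
              Σ[ τ ∈ (T → C) ] (Congruent _~_ _≡_ τ × Injective _~_ _≡_ τ)
    covered hit = (λ t → proj₁ (small w) (proj₁ (code t)) (proj₂ (code t)))
                , (λ e → cong (λ c → proj₁ (small w) (proj₁ c) (proj₂ c)) (code-cong e))
                , λ {t} {t′} e → code-injective {t} {t′} (proj₂ (small w) e)
      where
      Segment : Set (a ⊔ r)
      Segment = Σ[ v ∈ W ] v < w
      -- The set of all hits depends only on the class of `t`, so an element chosen from it is a
      -- code that respects `~`.
      hits : T → Segment → Bool
      hits t (v , p) = ⌊ f v p ~ t ⌋
      hits-nonempty : ∀ t → ∃ λ s → hits t s ≡ true
      hits-nonempty t = let (v , p , e) = hit t in (v , p) , holds⇒true e
      code : T → Segment
      code t = choose (hits t) (hits-nonempty t)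
      code-~ : ∀ t → f (proj₁ (code t)) (proj₂ (code t)) ~ t
      code-~ t = true⇒holds (choose-∈ (hits t) (hits-nonempty t))
      code-cong : ∀ {t t′} → t ~ t′ → code t ≡ code t′
      code-cong {t} {t′} e = choose-cong
        (ext λ _ → ⌊⌋-cong (λ h → ~-trans h e) (λ h → ~-trans h (~-sym e))) _ _
      f-cong : ∀ {v v′ p p′} → v ≡ v′ → f v p ≡ f v′ p′
      f-cong {v} refl = cong (f v) (<-irrelevant _ _)
      code-injective : ∀ {t t′} → proj₁ (code t) ≡ proj₁ (code t′) → t ~ t′
      code-injective {t} {t′} e =
        ~-trans (~-sym (code-~ t)) (subst (_~ t′) (sym (f-cong e)) (code-~ t′))

  select′ : ∀ {w} → Acc _<_ w → T
  select′ {w} (acc rs) = proj₁ (fresh w (λ v p → select′ (rs p)))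

  -- Needed so that the value avoided during the recursion at `w` is the value selected at `v`,
  -- whichever accessibility proof computes it.
  acc-irrelevant : ∀ {w} (p q : Acc _<_ w) → p ≡ q
  acc-irrelevant (acc rs) (acc rs′) = cong acc
    (implicit-extensionality ext (ext λ p → acc-irrelevant (rs p) (rs′ p)))

  select′-fresh : ∀ {v w} → v < w → (p : Acc _<_ v) (q : Acc _<_ w) →
                  ¬ select′ p ~ select′ q
  select′-fresh {v} {w} v<w p (acc rs) e
    rewrite acc-irrelevant p (rs v<w) =
    proj₂ (fresh w (λ v p → select′ (rs p))) v v<w e

  select : W → T
  select w = select′ (wellFounded w)

  select-injective : ∀ {v w} → select v ~ select w → v ≡ w
  select-injective {v} {w} e = by-contradiction λ v≢w →
    [ (λ v<w → select′-fresh v<w (wellFounded v) (wellFounded w) e)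
    , (λ w<v → select′-fresh w<v (wellFounded w) (wellFounded v) (~-sym e)) ]
    (connected v≢w)

-- Zermelo's well-ordering of a set

module WellOrdering (em : ∀ {a} → ExcludedMiddle a)
  (ext : ∀ {a b} → Extensionality a b) {ℓ : Level} (X : Set ℓ) where
  open Classical em

  Subset : Set ℓ
  Subset = X → Bool

  Proper : Subset → Set ℓ
  Proper S = ∃ λ x → not (S x) ≡ true

  Chosen : Subset → X → Set ℓ
  Chosen S x = Σ[ ne ∈ Proper S ] choose (not ∘ S) ne ≡ x

  chosen-unique : ∀ {S x y} → Chosen S x → Chosen S y → x ≡ y
  chosen-unique (ne , refl) (ne′ , refl) = choose-cong refl ne ne′

  -- Codes for the subsets obtained from the empty one by adjoining chosen elements and
  -- taking unions, as in Zermelo's proof.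
  data Tower : Set (suc ℓ) where
    step  : Tower → Tower
    union : (J : Set ℓ) → (J → Tower) → Tower

  infix 4 _∈_
  _∈_ : X → Tower → Set ℓ
  ⟦_⟧ : Tower → Subset

  x ∈ step t    = x ∈ t ⊎ Chosen ⟦ t ⟧ x
  x ∈ union J F = Σ[ j ∈ J ] x ∈ F j
  ⟦ t ⟧ x = ⌊ x ∈ t ⌋

  infix 4 _⊆_
  _⊆_ : Tower → Tower → Set ℓ
  t ⊆ s = ∀ x → x ∈ t → x ∈ s

  ⟦⟧-cong : ∀ {t s} → t ⊆ s → s ⊆ t → ⟦ t ⟧ ≡ ⟦ s ⟧
  ⟦⟧-cong t⊆s s⊆t = ext λ x → ⌊⌋-cong (t⊆s x) (s⊆t x)

  step-mono : ∀ {t s} → t ⊆ s → s ⊆ t → step t ⊆ step s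
  step-mono t⊆s s⊆t x (inj₁ m) = inj₁ (t⊆s x m)
  step-mono {t} {s} t⊆s s⊆t x (inj₂ c) =
    inj₂ (subst (λ S → Chosen S x) (⟦⟧-cong {t} {s} t⊆s s⊆t) c)

  -- Induction on both codes. In the critical case `r ⊆ s`, the swapped call `comparable s r` either
  -- gives `step r ⊆ s` or shows that `r` and `s` are the same subset, whose steps then agree.
  comparable : ∀ t s → t ⊆ s ⊎ step s ⊆ t
  comparable (union J F) s with em {P = Σ[ j ∈ J ] step s ⊆ F j}
  ... | yes (j , s⊆) = inj₂ λ x m → j , s⊆ x m
  ... | no ¬s⊆       = inj₁ λ x (j , m) →
    [ (λ ⊆s → ⊆s x m) , (λ s⊆ → ⊥-elim (¬s⊆ (j , s⊆))) ] (comparable (F j) s)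
  comparable (step r) s with comparable r s
  ... | inj₂ s⊆r = inj₂ λ x m → inj₁ (s⊆r x m)
  ... | inj₁ r⊆s with comparable s r
  ...   | inj₂ r⊆s′ = inj₁ r⊆s′
  ...   | inj₁ s⊆r  = inj₂ (step-mono {s} {r} s⊆r r⊆s)

  _⊏_ : X → X → Set (suc ℓ)
  x ⊏ y = Σ[ t ∈ Tower ] (x ∈ t × ¬ y ∈ t)

  -- The union of the stages that omit x; the indexing by subsets keeps it small.
  before : X → Tower
  before x = union
    (Σ[ S ∈ Subset ] ⌊ (Σ[ t ∈ Tower ] (⟦ t ⟧ ≡ S × ¬ x ∈ t)) ⌋ ≡ true)
    (λ (S , e) → proj₁ (true⇒holds e))

  ⊆-before : ∀ {x t} → ¬ x ∈ t → t ⊆ before x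
  ⊆-before {x} {t} x∉t y y∈t =
    (⟦ t ⟧ , e) , true⇒holds (trans (cong (λ S → S y) (proj₁ (proj₂ (true⇒holds e))))
                                    (holds⇒true y∈t))
    where
    e : ⌊ (Σ[ s ∈ Tower ] (⟦ s ⟧ ≡ ⟦ t ⟧ × ¬ x ∈ s)) ⌋ ≡ true
    e = holds⇒true (t , refl , x∉t)

  ∉-before : ∀ x → ¬ x ∈ before x
  ∉-before x ((S , e) , m) = proj₂ (proj₂ (true⇒holds e)) m

  chosen-∉ : ∀ {t x} → Chosen ⟦ t ⟧ x → ¬ x ∈ t
  chosen-∉ {t} (ne , refl) m
    with choose-∈ (not ∘ ⟦ t ⟧) ne
  ... | e rewrite holds⇒true m with () ← e

  -- Otherwise `step (before x)` still omits `x`, so it lies inside `before x`, although it contains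
  -- the element chosen outside `before x`.
  chosen-before : ∀ x → Chosen ⟦ before x ⟧ x
  chosen-before x = by-contradiction λ unchosen →
    chosen-∉ {before x} (ne , refl)
      (⊆-before {x} {step (before x)} [ ∉-before x , unchosen ] _ (inj₂ (ne , refl)))
    where
    ne : Proper ⟦ before x ⟧
    ne = x , cong not (fails⇒false (∉-before x))

  -- If `x` is the element added by `step t`, a stage omitting `x` cannot include `step t`; hence it
  -- lies in `t`, and all predecessors of `x` are covered by induction.
  accessible : ∀ t {x} → x ∈ t → Acc _⊏_ x
  accessible (union J F) (j , m) = accessible (F j) m
  accessible (step t) (inj₁ m) = accessible t m
  accessible (step t) {x} (inj₂ c) = acc λ {y} (s , y∈s , x∉s) →
    accessible t ([ (λ s⊆t → s⊆t y y∈s) , (λ t⊆s → ⊥-elim (x∉s (t⊆s x (inj₂ c)))) ]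
      (comparable s t))

  ⊏-wellFounded : WellFounded _⊏_
  ⊏-wellFounded x = accessible (step (before x)) (inj₂ (chosen-before x))

  ⊏-connected : ∀ {x y} → ¬ x ≡ y → x ⊏ y ⊎ y ⊏ x
  ⊏-connected {x} {y} x≢y with em {P = x ⊏ y} | em {P = y ⊏ x}
  ... | yes p | _     = inj₁ p
  ... | _     | yes q = inj₂ q
  -- The same stages omit `x` and `y`, so both are the element chosen outside one and the same
  -- subset.
  ... | no ¬p | no ¬q = ⊥-elim (x≢y (chosen-unique (chosen-before x)
    (subst (λ S → Chosen S y)
      (⟦⟧-cong {before y} {before x} (before-⊆ ¬p) (before-⊆ ¬q))
      (chosen-before y))))
    where
    before-⊆ : ∀ {x y} → ¬ x ⊏ y → before y ⊆ before x
    before-⊆ {x} {y} ¬p z ((S , e) , m) =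
      let (t , _ , y∉t) = true⇒holds e
      in ⊆-before {x} {t} (λ x∈t → ¬p (t , x∈t , y∉t)) z m

-- The Hartogs construction inside the power set

module Hartogs (em : ∀ {a} → ExcludedMiddle a)
  (ext : ∀ {a b} → Extensionality a b) {ℓ : Level} (C : Set ℓ) where
  open Classical em
  open WellOrdering em ext (C → Bool)

  cantor : ¬ ((C → Bool) ↣ C)
  cantor f = contra (em {P = Diagonal (to D)})
    where
    open Injection f using (to; injective)
    Diagonal : C → Set ℓ
    Diagonal c = Σ[ S ∈ (C → Bool) ] (to S ≡ c × S c ≡ false)
    D : C → Bool
    D c = ⌊ Diagonal c ⌋
    ¬diagonal : ¬ Diagonal (to D)
    ¬diagonal (S , e , S∌) with injective e
    ... | refl = false⇒fails S∌ (S , e , S∌)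
    contra : Dec (Diagonal (to D)) → _
    contra (yes d) = ¬diagonal d
    contra (no ¬d) = ¬diagonal (D , refl , fails⇒false ¬d)

  Small : (C → Bool) → Set (suc ℓ)
  Small = SmallSegment _⊏_ C

  -- The well-ordered power set supplies the elements, cut down to those with at most `C`-many
  -- predecessors. The Boolean test brings the large proposition `Small S` down to level `ℓ`.
  Hartogs : Set ℓ
  Hartogs = Σ[ S ∈ (C → Bool) ] ⌊ Small S ⌋ ≡ true

  infix 4 _<_
  _<_ : Rel Hartogs _
  (S , _) < (S′ , _) = ⌊ S ⊏ S′ ⌋ ≡ true

  hartogs-≡ : ∀ {x y : Hartogs} → proj₁ x ≡ proj₁ y → x ≡ y
  hartogs-≡ refl = cong (_ ,_) (uip _ _)

  <-irrelevant : Irrelevant _<_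
  <-irrelevant = uip

  <-wellFounded : WellFounded _<_
  <-wellFounded x = accessible′ (⊏-wellFounded (proj₁ x))
    where
    accessible′ : ∀ {x} → Acc _⊏_ (proj₁ x) → Acc _<_ x
    accessible′ (acc rs) = acc λ p → accessible′ (rs (true⇒holds p))

  <-connected : ∀ {x y} → ¬ x ≡ y → x < y ⊎ y < x
  <-connected x≢y = map holds⇒true holds⇒true (⊏-connected (x≢y ∘ hartogs-≡))

  <-small : ∀ x → SmallSegment _<_ C x
  <-small (S , e) = let (g , g-injective) = true⇒holds e in
    (λ y p → g (proj₁ y) (true⇒holds p)) , (λ e → hartogs-≡ (g-injective e))

  -- Given such an injection, well-founded induction makes every subset `Small`: its predecessors
  -- are in `Hartogs` and so inject into `C`. Then the whole power set injects into `C`, against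
  -- `cantor`.
  hartogs-large : ¬ (Hartogs ↣ C)
  hartogs-large f = cantor (mk↣ {to = λ S → to (S , all-small S)}
    (λ e → cong proj₁ (injective e)))
    where
    open Injection f using (to; injective)
    small : ∀ {S} → Acc _⊏_ S → Small S
    small (acc rs) = (λ S p → to (S , holds⇒true (small (rs p))))
                   , (λ e → cong proj₁ (injective e))
    all-small : ∀ S → ⌊ Small S ⌋ ≡ true
    all-small S = holds⇒true (small (⊏-wellFounded S))

  module _ {t q : Level} {T : Set t} {_~_ : Rel T q} (isEquivalence : IsEquivalence _~_)
    (many : ¬ (Σ[ τ ∈ (T → C) ] (Congruent _~_ _≡_ τ × Injective _~_ _≡_ τ))) where
    open Selection em ext {_<_ = _<_} <-wellFounded (λ {x} {y} → <-irrelevant {x} {y})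
      <-connected <-small
      isEquivalence many public

-- Both injections come from `Selection`: along the order of `κ` into the Hartogs set, and along the
-- order of the Hartogs set into `J`. In each case the segments are small and the target does not
-- inject into `κ`.
hartogs-isSuccessor : (em : ∀ {a} → ExcludedMiddle a)
  (ext : ∀ {a b} → Extensionality a b) {ℓ : Level} (κ : Cardinal ℓ) →
  HasSuccessorCardinality κ (Hartogs.Hartogs em ext (Cardinal.Carrier κ))
hartogs-isSuccessor em ext κ = (below , hartogs-large) , above
  where
  open Cardinal κ
  open Hartogs em ext Carrier hiding (_<_; <-irrelevant)
  connected : ∀ {v w} → ¬ v ≡ w → v < w ⊎ w < v
  connected {v} {w} v≢w with IsStrictTotalOrder.compare isStrictTotalOrder v w
  ... | tri< p _ _ = inj₁ p
  ... | tri≈ _ e _ = ⊥-elim (v≢w e)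
  ... | tri> _ _ p = inj₂ p
  segment : ∀ w → SmallSegment _<_ Carrier w
  segment w = (λ v _ → v) , (λ e → e)
  module Below = Selection em ext {_<_ = _<_} {T = Hartogs} {_~_ = _≡_} {C = Carrier}
    wellFounded (λ {x} {y} → <-irrelevant {x} {y}) connected segment ≡-isEquivalence
    (λ (τ , _ , inj) → hartogs-large (mk↣ inj))
  below : Carrier ↣ Hartogs
  below = mk↣ {to = Below.select} Below.select-injective
  above : ∀ J → Carrier ≺ J → Hartogs ↣ J
  above J (_ , J-large) = mk↣ {to = select ≡-isEquivalence many}
    (select-injective ≡-isEquivalence many)
    where
    many : ¬ (Σ[ τ ∈ (J → Carrier) ] (Congruent _≡_ _≡_ τ × Injective _≡_ _≡_ τ))
    many (τ , _ , inj) = J-large (mk↣ inj)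

-- Sheaves for the atomic topology

module AtomicSheaves (em : ∀ {a} → ExcludedMiddle a)
  (ext : ∀ {a b} → Extensionality a b) {o h v : Level} (C : Category o h) where
  open Classical em
  open Category C renaming (_∘_ to _∙_)
  open SheafMorphism

  site : Category o h
  site = C ᵒᵖ

  topos : Category (o ⊔ h ⊔ suc v) (o ⊔ h ⊔ v)
  topos = Sh ext {v = v} site (Jat site)

  open Category topos using () renaming (Obj to AtomicSheaf; _⇒_ to _⟶_; _∘_ to _⊙_)
  open Sheaf using (F₀; F₁; F-id; F-∘; isSheaf)

  -- A single arrow covers, and both `x` and `y` glue the same one-member family.
  separated : ∀ (F : AtomicSheaf) {A B} (f : A ⇒ B) {x y : F₀ F A} →
              F₁ F f x ≡ F₁ F f y → x ≡ y
  separated F {A} {B} f {x} {y} e = trans (sym (unique λ _ → refl)) (unique λ _ → sym e)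
    where
    cover : Family site v A
    cover = record { Index = ⊤ ; dom = λ _ → B ; arr = λ _ → f }
    compatible : Compatible (Sheaf.presheaf F) cover (λ _ → F₁ F f x)
    compatible p q pf≡qf = trans (sym (F-∘ F f p x))
      (trans (cong (λ g → F₁ F g x) pf≡qf) (F-∘ F f q x))
    unique : ∀ {z} → (∀ _ → F₁ F f z ≡ F₁ F f x) → _ ≡ z
    unique = proj₂ (proj₂ (isSheaf F cover tt _ compatible))

  -- Every nonempty family covers, so a preimage over one extension replaces preimages over a
  -- covering family.
  LocallySurjective : ∀ {F G} → F ⟶ G → Set (o ⊔ h ⊔ v)
  LocallySurjective {F} {G} α = ∀ A (y : F₀ G A) →
    Σ[ B ∈ Obj ] Σ[ f ∈ A ⇒ B ] Σ[ x ∈ F₀ F B ] η α B x ≡ F₁ G f y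

  locallySurjective⇒epi : ∀ {F G} (α : F ⟶ G) → LocallySurjective α → Epi topos α
  locallySurjective⇒epi {F} {G} α surj {Z} β γ βα≡γα = SheafMorphism-≡ ext λ A y →
    let (B , f , x , e) = surj A y in
    separated Z f (trans (sym (natural β f y)) (trans (cong (η β B) (sym e))
      (trans (cong (λ δ → η δ B x) βα≡γα) (trans (cong (η γ B) e) (natural γ f y)))))

  module _ (amalgamation : AmalgamationProperty C) where

    -- By amalgamation any two covering arrows complete to a square, so compatible families are
    -- constant; nonemptiness of the cover provides the value.
    constant : Set v → AtomicSheaf
    constant X = record
      { presheaf = record
          { F₀   = λ _ → X
          ; F₁   = λ _ x → x
          ; F-id = λ _ → refl
          ; F-∘  = λ _ _ _ → refl
          }
      ; isSheaf  = λ R i x compatible → x i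
          , (λ j → let (_ , p , q , e) = amalgamation (Family.arr R i) (Family.arr R j)
                   in compatible p q e)
          , (λ e → sym (e i))
      }

    -- An epimorphism equalizes the characteristic map of its local image and the constant
    -- map true, so these two are equal.
    epi⇒locallySurjective : ∀ {F G} (α : F ⟶ G) → Epi topos α → LocallySurjective α
    epi⇒locallySurjective {F} {G} α epi A y =
      true⇒holds (cong lower (cong (λ β → η β A y) (epi χ always χα≡always)))
      where
      Hit : ∀ A → F₀ G A → Set (o ⊔ h ⊔ v)
      Hit A y = Σ[ B ∈ Obj ] Σ[ f ∈ A ⇒ B ] Σ[ x ∈ F₀ F B ] η α B x ≡ F₁ G f y
      Ω : AtomicSheaf
      Ω = constant (Lift v Bool)
      -- Being hit is invariant under restriction in both directions, which makes the two-valued `χ`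
      -- natural; this direction amalgamates `f` with the witnessing extension.
      forth : ∀ {A B} (f : A ⇒ B) y → Hit A y → Hit B (F₁ G f y)
      forth f y (B , g , x , e) =
        let (D , p , q , pf≡qg) = amalgamation f g in
        D , p , F₁ F q x , trans (natural α q x) (trans (cong (F₁ G q) e)
          (trans (sym (F-∘ G g q y)) (trans (cong (λ k → F₁ G k y) (sym pf≡qg))
          (F-∘ G f p y))))
      back : ∀ {A B} (f : A ⇒ B) y → Hit B (F₁ G f y) → Hit A y
      back f y (B , g , x , e) = B , g ∙ f , x , trans e (sym (F-∘ G f g y))
      χ : G ⟶ Ω
      χ = record
        { η       = λ A y → lift ⌊ Hit A y ⌋
        ; natural = λ f y → cong lift (⌊⌋-cong (back f y) (forth f y))
        }
      always : G ⟶ Ω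
      always = record { η = λ _ _ → lift true ; natural = λ _ _ → refl }
      χα≡always : χ ⊙ α ≡ always ⊙ α
      χα≡always = SheafMorphism-≡ ext λ A x →
        cong lift (holds⇒true (A , id , x , sym (F-id G _)))

  module _ {I : Set v} (X : I → AtomicSheaf) where

    ∏-sheaf : AtomicSheaf
    ∏-sheaf = record
      { presheaf = record
          { F₀   = λ A → ∀ i → F₀ (X i) A
          ; F₁   = λ f x i → F₁ (X i) f (x i)
          ; F-id = λ x → ext λ i → F-id (X i) (x i)
          ; F-∘  = λ g f x → ext λ i → F-∘ (X i) g f (x i)
          }
      ; isSheaf  = λ R r x compatible →
          let glued i = isSheaf (X i) R r (λ j → x j i)
                          (λ p q e → cong (λ y → y i) (compatible p q e))
          in (λ i → proj₁ (glued i))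
           , (λ j → ext λ i → proj₁ (proj₂ (glued i)) j)
           , (λ e → ext λ i → proj₂ (proj₂ (glued i)) λ j → cong (λ y → y i) (e j))
      }

    ∏-product : Product topos X
    ∏-product = record
      { ∏         = ∏-sheaf
      ; π         = λ i → record { η = λ A x → x i ; natural = λ f x → refl }
      ; ⟨_⟩       = λ f → record
          { η       = λ A z i → η (f i) A z
          ; natural = λ g z → ext λ i → natural (f i) g z
          }
      ; π-⟨⟩      = λ f i → SheafMorphism-≡ ext λ A z → refl
      ; ⟨⟩-unique = λ f u e → SheafMorphism-≡ ext λ A z → ext λ i →
                      cong (λ α → η α A z) (e i)
      }

    module _ (PX : Product topos X) where
      open Product PX

      tuple : ∀ {A} → (∀ i → F₀ (X i) A) → F₀ ∏ A
      tuple {A} = η ⟨ Product.π ∏-product ⟩ A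

      π-tuple : ∀ {A} (x : ∀ i → F₀ (X i) A) i → η (π i) A (tuple x) ≡ x i
      π-tuple {A} x i = cong (λ α → η α A x) (π-⟨⟩ (Product.π ∏-product) i)

      -- An arbitrary product is a retract of the pointwise one, by uniqueness of its mediating
      -- maps; so its elements too are determined by their components.
      components-injective : ∀ {A} {x y : F₀ ∏ A} →
                             (∀ i → η (π i) A x ≡ η (π i) A y) → x ≡ y
      components-injective {A} {x} {y} e =
        trans (sym (tuple-components x)) (trans (cong tuple (ext e)) (tuple-components y))
        where
        components : ∏ ⟶ ∏-sheaf
        components = Product.⟨_⟩ ∏-product π
        retract : ⟨ Product.π ∏-product ⟩ ⊙ components ≡ Category.id topos
        retract = trans
          (⟨⟩-unique π (⟨ Product.π ∏-product ⟩ ⊙ components) λ i →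
            SheafMorphism-≡ ext λ B z → π-tuple (λ i → η (π i) B z) i)
          (sym (⟨⟩-unique π (Category.id topos) λ i → SheafMorphism-≡ ext λ _ _ → refl))
        tuple-components : ∀ z → tuple (λ i → η (π i) A z) ≡ z
        tuple-components z = cong (λ α → η α A z) retract

  -- Read in the opposite category, this says that an `I`-indexed family of one-arrow covers of `A`
  -- has a common one-arrow refinement.
  JointExtensions : Set v → Set (o ⊔ h ⊔ v)
  JointExtensions I = ∀ {A} {B : I → Obj} (f : ∀ i → A ⇒ B i) →
    Σ[ M ∈ Obj ] Σ[ z ∈ A ⇒ M ] ∀ i → Σ[ u ∈ B i ⇒ M ] u ∙ f i ≡ z

  jointExtensions⇒choice : AmalgamationProperty C → ∀ {I : Set v} →
    JointExtensions I → ChoiceForFamiliesOver topos I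
  jointExtensions⇒choice amalgamation joint X Y g epi PX PY =
    locallySurjective⇒epi (∏-map topos PX PY g) surj
    where
    open Product
    surj : LocallySurjective (∏-map topos PX PY g)
    surj A y = M , z , tuple X PX x , components-injective Y PY same
      where
      hit : ∀ i → _
      hit i = epi⇒locallySurjective amalgamation (g i) (epi i) A (η (π PY i) A y)
      extension = joint (λ i → proj₁ (proj₂ (hit i)))
      M : Obj
      M = proj₁ extension
      z : A ⇒ M
      z = proj₁ (proj₂ extension)
      u : ∀ i → proj₁ (hit i) ⇒ M
      u i = proj₁ (proj₂ (proj₂ extension) i)
      x : ∀ i → F₀ (X i) M
      x i = F₁ (X i) (u i) (proj₁ (proj₂ (proj₂ (hit i))))
      same : ∀ i → η (π PY i) M (η (∏-map topos PX PY g) M (tuple X PX x)) ≡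
                   η (π PY i) M (F₁ (∏ PY) z y)
      same i = trans (cong (λ α → η α M (tuple X PX x)) (π-⟨⟩ PY (λ i → g i ⊙ π PX i) i))
        (trans (cong (η (g i) M) (π-tuple X PX x i))
        (trans (natural (g i) (u i) _)
        (trans (cong (F₁ (Y i) (u i)) (proj₂ (proj₂ (proj₂ (hit i)))))
        (trans (sym (F-∘ (Y i) _ (u i) _))
        (trans (cong (λ f → F₁ (Y i) f (η (π PY i) A y)) (proj₂ (proj₂ (proj₂ extension) i)))
               (sym (natural (π PY i) z y)))))))

module _ (em : ∀ {a} → ExcludedMiddle a) (ext : ∀ {a b} → Extensionality a b)
  {o h : Level} (C : Category o h) (amalgamation : AmalgamationProperty C)
  (subcanonical : Subcanonical (C ᵒᵖ) (Jat (C ᵒᵖ))) where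
  open AtomicSheaves em ext {v = h} C
  open Category C renaming (_∘_ to _∙_)
  open SheafMorphism

  choice⇒jointExtensions : ∀ {I : Set h} → ChoiceForFamiliesOver topos I →
                           JointExtensions I
  choice⇒jointExtensions {I} choice {A} {B} f =
    let (M , z , u , e) = epi⇒locallySurjective amalgamation _
          (choice (λ i → y (B i)) (λ _ → y A) restriction restriction-epi
            (∏-product (λ i → y (B i))) (∏-product (λ _ → y A)))
          A (λ _ → id)
    in M , z , λ i → u i , trans (cong (λ x → x i) e) (identityʳ z)
    where
    y : Obj → Category.Obj topos
    y A = record { presheaf = representable (C ᵒᵖ) A ; isSheaf = subcanonical A }
    restriction : ∀ i → Category._⇒_ topos (y (B i)) (y A)
    restriction i = record { η = λ D u → u ∙ f i ; natural = λ g u → assoc g u (f i) }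
    -- An arrow `u` out of `A` extends along `f i` once it is prolonged into an amalgam of `f i` and
    -- `u`.
    restriction-epi : ∀ i → Epi topos (restriction i)
    restriction-epi i = locallySurjective⇒epi (restriction i) λ D u →
      let (E , p , q , e) = amalgamation (f i) u in E , q , p , e

theorem5p6 :
    (em : ∀ {a} → ExcludedMiddle a) (ext : ∀ {a b} → Extensionality a b) →
    ∀ {o ℓ} (κ : Cardinal ℓ) → Infinite κ →
    (K : StructureClass o ℓ) →
    let Kκ      = K ↾ κ
        site    = ConcreteCategory.category Kκ ᵒᵖ
        topos   = Sh ext {v = ℓ} site (Jat site)
        stable  = GaloisStable K κ
        choice⁺ = ∀ (I : Set ℓ) → HasSuccessorCardinality κ I →
                  ChoiceForFamiliesOver topos I
        choice  = ∀ (I : Set ℓ) → ChoiceForFamiliesOver topos I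
    in
    IsSubcanonicalAPClass Kκ →
    TarskiVaught Kκ κ →
    (stable ⇔ choice⁺) × (choice⁺ ⇔ choice)
theorem5p6 em ext κ infinite K isAPClass tarskiVaught =
    mk⇔ (λ stable I _ → stable⇒choice stable I) choice⁺⇒stable
  , mk⇔ (λ choice⁺ → stable⇒choice (choice⁺⇒stable choice⁺)) (λ choice I _ → choice I)
  where
  module K = StructureClass K
  open IsSubcanonicalAPClass isAPClass
  open ConcreteCategory (K ↾ κ)
  open AtomicSheaves em ext category using (topos; jointExtensions⇒choice)
  open PointedExtension using (point)

  stable⇒choice : GaloisStable K κ → ∀ I → ChoiceForFamiliesOver topos I
  stable⇒choice stable I = jointExtensions⇒choice amalgamation
    (Stable.universal-extension em ext (K ↾ κ) κ (Injection.to infinite 0)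
      (λ f → K.injective (BoundedHom.hom f)) BoundedObj.bound
      coherence amalgamation tarskiVaught stable)

  choice⁺⇒stable : (∀ I → HasSuccessorCardinality κ I → ChoiceForFamiliesOver topos I) →
                   GaloisStable K κ
  choice⁺⇒stable choice⁺ A = Classical.by-contradiction em λ many →
    let open Hartogs em ext (Cardinal.Carrier κ)
        open GaloisTypes (K ↾ κ) amalgamation
        type = select sameType-isEquivalence many
        (M , z , u) = choice⇒jointExtensions em ext category amalgamation subcanonical
          (choice⁺ Hartogs (hartogs-isSuccessor em ext κ))
          (λ i → PointedExtension.ext (type i))
        realization i = ⟦ proj₁ (u i) ⟧ (point (type i))
        realization-injective : Injective _≡_ _≡_ realization
        -- `M` amalgamates the `i`-th and `j`-th extensions over `A`, so equal realizations would
        -- make the two selected types equal.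
        realization-injective {i} {j} e = select-injective sameType-isEquivalence many
          ((M , proj₁ (u i) , proj₁ (u j) , trans (proj₂ (u i)) (sym (proj₂ (u j)))) , e)
    in hartogs-large (mk↣ {to = λ i → Injection.to (BoundedObj.bound M) (realization i)}
         (λ e → realization-injective (Injection.injective (BoundedObj.bound M) e)))
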